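{- Let $n\ge 2$ and $h\ge k\ge 1$ be integers with $k\le\lg n$. Then the number of leaves of the $k$-Strahler $(n,h)$-universal ordered tree $U^k_{\lfloor\lg n\rfloor,h}$ is $$n^{O(1)}\cdot\left(\frac{h}{k}\right)^{k}\;=\;n^{\,k\lg(h/k)/\lg n\,+\,O(1)},$$ which is polynomial in $n$ if $k\cdot\lg(h/k)=O(\log n)$. In more detail, the number of leaves is at most $n^{c(n)}\cdot(h/k)^k$, where $c(n)=5.45$ if $k\le\lg n$; $c(n)=3+o(1)$ if $k=o(\log n)$ (as a function of $n$); and $c(n)=1+o(1)$ if $k=O(1)$.
   Context: $\lg$ is the base-2 logarithm. Ordered trees: the trivial tree $\langle\rangle$ (a single node, which is a leaf) is an ordered tree, and so is a sequence $\langle T_1,\dots,T_\ell\rangle$ ($\ell\ge1$) of ordered trees (a root whose children are the roots of $T_1,\dots,T_\ell$). The number of leaves is $1$ for the trivial tree and the sum of the numbers of leaves of the $T_i$ otherwise; the height is $1$ for the trivial tree and $1+\max_i\mathrm{height}(T_i)$ otherwise. A tree is $(n,h)$-small if it has at most $n$ leaves and height at most $h$. The Strahler number is defined by $\mathrm{Str}(\langle\rangle)=1$ and, for $T=\langle T_1,\dots,T_\ell\rangle$ with $m=\max_i\mathrm{Str}(T_i)$, $\mathrm{Str}(T)=m$ if there is a unique $i$ with $\mathrm{Str}(T_i)=m$, and $\mathrm{Str}(T)=m+1$ otherwise. The symbol $\cdot$ between trees denotes concatenation of sequences (merging roots). The trivial tree can be embedded in every ordered tree; $\langle T_1,\dots,T_a\rangle$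 can be embedded in $\langle T'_1,\dots,T'_b\rangle$ if there are $1\le i_1<\dots<i_a\le b$ such that each $T_j$ can be embedded in $T'_{i_j}$. A tree is $k$-Strahler $(n,h)$-universal if every $(n,h)$-small ordered tree of Strahler number at most $k$ can be embedded in it. For all $t\ge 0$, the trees $U^k_{t,h}$ ($h\ge k\ge1$) and $V^k_{t,h}$ ($h\ge k\ge 2$) are defined by mutual induction: (1) if $h=k=1$ then $U^k_{t,h}=\langle\rangle$; (2) if $h>1$ and $k=1$ then $U^k_{t,h}=\langle U^k_{t,h-1}\rangle$; (3) if $h\ge k\ge2$ and $t=0$ then $U^k_{t,h}=V^k_{t,h}=\langle U^{k-1}_{t,h-1}\rangle$; (4) if $h\ge k\ge 2$ and $t\ge1$ then $V^k_{t,h}=V^k_{t-1,h}\cdot\langle U^{k-1}_{t,h-1}\rangle\cdot V^k_{t-1,h}$; (5) if $h=k\ge2$ and $t\ge1$ then $U^k_{t,h}=V^k_{t,h}$; (6) if $h>k\ge2$ and $t\ge1$ then $U^k_{t,h}=V^k_{t,h}\cdot\langle U^k_{t,h-1}\rangle\cdot V^k_{t,h}$. -}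

module Defs where

open import Algebra.Definitions.RawSemiring using (_^_)
open import Data.Bool.Base using (if_then_else_)
open import Data.Integer.Base as ℤ using (+_; -[1+_])
open import Data.List.Base using (List; []; _∷_; _++_; foldr; filter; length)
open import Data.List.Relation.Binary.Sublist.Heterogeneous using (Sublist)
open import Data.Nat.Base as ℕ using (ℕ; zero; suc; _⊔_; _≡ᵇ_)
import Data.Nat.Properties as ℕ
open import Data.Product.Base using (_×_; ∃-syntax)
open import Data.Rational.Base as ℚ using (ℚ; mkℚ; 0ℚ; 1ℚ; _/_)

------------------------------------------------------------------------
-- Ordered trees

data Tree : Set where
  ⟨_⟩ : List Tree → Tree

-- Merging roots.
infixr 5 _·_
_·_ : Tree → Tree → Tree
⟨ Ss ⟩ · ⟨ Ts ⟩ = ⟨ Ss ++ Ts ⟩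

maximum : List ℕ → ℕ
maximum = foldr _⊔_ 0

mutual
  leaves : Tree → ℕ
  leaves ⟨ []     ⟩ = 1
  leaves ⟨ T ∷ Ts ⟩ = leaves T ℕ.+ leaves* Ts

  leaves* : List Tree → ℕ
  leaves* []       = 0
  leaves* (T ∷ Ts) = leaves T ℕ.+ leaves* Ts

mutual
  height : Tree → ℕ
  height ⟨ Ts ⟩ = suc (maximum (heights Ts))

  heights : List Tree → List ℕ
  heights []       = []
  heights (T ∷ Ts) = height T ∷ heights Ts

occurrences : ℕ → List ℕ → ℕ
occurrences m xs = length (filter (ℕ._≟ m) xs)

-- The Strahler number of a node from those of its children.
strahlerNode : List ℕ → ℕ
strahlerNode []          = 1
strahlerNode xs@(_ ∷ _) =
  let m = maximum xs in if occurrences m xs ≡ᵇ 1 then m else suc m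

mutual
  strahler : Tree → ℕ
  strahler ⟨ Ts ⟩ = strahlerNode (strahlers Ts)

  strahlers : List Tree → List ℕ
  strahlers []       = []
  strahlers (T ∷ Ts) = strahler T ∷ strahlers Ts

infix 4 _↪_
data _↪_ : Tree → Tree → Set where
  trivial : ∀ {T} → ⟨ [] ⟩ ↪ T
  node    : ∀ {Ss Ts} → Sublist _↪_ Ss Ts → ⟨ Ss ⟩ ↪ ⟨ Ts ⟩

Small : ℕ → ℕ → Tree → Set
Small n h T = leaves T ℕ.≤ n × height T ℕ.≤ h

StrahlerUniversal : (k n h : ℕ) → Tree → Set
StrahlerUniversal k n h U =
  ∀ T → Small n h T → strahler T ℕ.≤ k → T ↪ U

------------------------------------------------------------------------
-- The trees U^k_{t,h} (h ≥ k ≥ 1) and V^k_{t,h} (h ≥ k ≥ 2), as functions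
-- of k, t, h in this order.  Outside the stated ranges their values are
-- irrelevant; inside them, no recursive call leaves the ranges.

mutual
  U : (k t h : ℕ) → Tree
  U zero          t       h             = ⟨ [] ⟩
  U (suc k)       t       zero          = ⟨ [] ⟩
  U (suc (suc k)) t       (suc zero)    = ⟨ [] ⟩
  U (suc zero)    t       (suc zero)    = ⟨ [] ⟩
  U (suc zero)    t       (suc (suc h)) = ⟨ U 1 t (suc h) ∷ [] ⟩
  U (suc (suc k)) zero    (suc (suc h)) = ⟨ U (suc k) 0 (suc h) ∷ [] ⟩
  U (suc (suc k)) (suc t) (suc (suc h)) =
    if h ≡ᵇ k
      then V (suc (suc k)) (suc t) (suc (suc h))
      else V (suc (suc k)) (suc t) (suc (suc h))
           · ⟨ U (suc (suc k)) (suc t) (suc h) ∷ [] ⟩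
           · V (suc (suc k)) (suc t) (suc (suc h))

  V : (k t h : ℕ) → Tree
  V zero          t       h             = ⟨ [] ⟩
  V (suc zero)    t       h             = ⟨ [] ⟩
  V (suc (suc k)) t       zero          = ⟨ [] ⟩
  V (suc (suc k)) t       (suc zero)    = ⟨ [] ⟩
  V (suc (suc k)) zero    (suc (suc h)) = ⟨ U (suc k) 0 (suc h) ∷ [] ⟩
  V (suc (suc k)) (suc t) (suc (suc h)) =
    V (suc (suc k)) t (suc (suc h))
    · ⟨ U (suc k) (suc t) (suc h) ∷ [] ⟩
    · V (suc (suc k)) t (suc (suc h))

------------------------------------------------------------------------
-- Real powers and logarithms.  There are no reals here: a relation between
-- them is expressed by clearing denominators in the exponents.

infixr 8 _^ℚ_
_^ℚ_ : ℚ → ℕ → ℚ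
_^ℚ_ = _^_ ℚ.+-*-rawSemiring

fromℕ : ℕ → ℚ
fromℕ n = + n / 1

-- x ≤[ n ^ r ]* y  means  x ≤ n^r · y,  for x, y ≥ 0 and n ≥ 1:
-- with r = p/q, both sides are raised to the q-th power, and n^p is moved
-- to the left when p is negative.
infix 4 _≤[_^_]*_
_≤[_^_]*_ : ℚ → ℕ → ℚ → ℚ → Set
x ≤[ n ^ mkℚ (+ p)    q-1 _ ]* y =
  x ^ℚ suc q-1 ℚ.≤ fromℕ n ^ℚ p ℚ.* y ^ℚ suc q-1
x ≤[ n ^ mkℚ -[1+ p ] q-1 _ ]* y =
  x ^ℚ suc q-1 ℚ.* fromℕ n ^ℚ suc p ℚ.≤ y ^ℚ suc q-1

-- k · lg x ≤ r · lg n,  for x > 0 and n ≥ 1, that is,  x^k ≤ n^r.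
infix 4 _·lg_≤_·lg_
_·lg_≤_·lg_ : ℕ → ℚ → ℚ → ℕ → Set
k ·lg x ≤ r ·lg n = x ^ℚ k ≤[ n ^ r ]* 1ℚ

-- A real number α, given by the set of all rationals r with α ≤ r.
UpperCut : Set₁
UpperCut = ℚ → Set

infixl 6 _⊕_
_⊕_ : UpperCut → ℚ → UpperCut
(α ⊕ c) r = α (r ℚ.- c)

-- k · lg x / lg n,  for n ≥ 2.
_·lg_/lg_ : ℕ → ℚ → ℕ → UpperCut
(k ·lg x /lg n) r = k ·lg x ≤ r ·lg n

-- x ≤ n^α  for a real exponent α.
infix 4 _≤[_^ᴿ_]
_≤[_^ᴿ_] : ℚ → ℕ → UpperCut → Set
x ≤[ n ^ᴿ α ] = ∀ r → α r → x ≤[ n ^ r ]* 1ℚ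

------------------------------------------------------------------------
-- Asymptotic notation, for n → ∞

-- f(n) = o(1)
IsLittleO[1] : (ℕ → ℚ) → Set
IsLittleO[1] f =
  ∀ ε → 0ℚ ℚ.< ε → ∃[ N ] ∀ n → N ℕ.≤ n → ℚ.∣ f n ∣ ℚ.≤ ε

-- k(n) = O(1)
IsBigO[1] : (ℕ → ℕ) → Set
IsBigO[1] k = ∃[ K ] ∃[ N ] ∀ n → N ℕ.≤ n → k n ℕ.≤ K

-- k(n) = o(log n).  Here k(n) = k(n) · lg 2; n ≥ 1 keeps lg n defined.
IsLittleO[log] : (ℕ → ℕ) → Set
IsLittleO[log] k =
  ∀ ε → 0ℚ ℚ.< ε →
  ∃[ N ] ∀ n → 1 ℕ.≤ n → N ℕ.≤ n → k n ·lg fromℕ 2 ≤ ε ·lg n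

{-# OPTIONS --safe #-}

-- Universality: split the children of the root at the median leaf, in V, or at
-- the only child whose Strahler number is that of the root, in U.
--
-- Leaves: the recurrences give
--   leaves (U (k+1) t h) · k! ≤ 2^(t+k) · C(t+k,k) · h^k.
-- With t = ⌊lg n⌋ and k + 1 ≤ t, both 2^(t+k) and C(t+k,k) ≤ 2^(t+k) are at most
-- n², and k^k / k! ≤ e^k with lg e < 1.45, whence 5.45 = 2 + 2 + 1.45.  If
-- k = o(log n), then 2^(t+k) is n^(1+o(1)) and e^k is n^o(1).  If k = O(1), then
-- moreover C(t+k,k) ≤ (t+1)^k is polylogarithmic.
module Submission where

open import Defs
open import Algebra.Bundles using (CommutativeRing)
import Algebra.Properties.CommutativeSemiring.Exp
open import Data.Bool.Base as Bool using (true; false; if_then_else_)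
import Data.Bool.Properties as Bool
open import Data.Integer.Base as ℤ using (+_; -[1+_])
import Data.Integer.Properties as ℤ
open import Data.List.Base using (List; []; _∷_; _++_; length)
open import Data.List.Properties using (filter-accept; filter-reject)
open import Data.List.Relation.Binary.Sublist.Heterogeneous using (Sublist; []; _∷_; minimum)
open import Data.List.Relation.Binary.Sublist.Heterogeneous.Properties using (++⁺; ++ʳ)
open import Data.List.Relation.Unary.All as All using (All; []; _∷_)
import Data.List.Relation.Unary.All.Properties as All
open import Data.Nat.Base hiding (_/_)
open import Data.Nat.Induction using (<-wellFounded)
open import Data.Nat.Logarithm using (⌊log₂_⌋; ⌊log₂⌋-mono-≤; ⌊log₂[2^n]⌋≡n)
open import Data.Nat.Logarithm.Core using (⌊log2⌋)
open import Data.Nat.Properties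
open import Data.Nat.Tactic.RingSolver using (solve-∀)
open import Data.Product.Base using (_×_; _,_; ∃-syntax)
open import Data.Rational.Base as ℚ using (ℚ; mkℚ; 0ℚ; 1ℚ; _/_; toℚᵘ; ↥_; ↧ₙ_)
import Data.Rational.Properties as ℚ
open import Data.Rational.Solver using (module +-*-Solver)
open import Data.Rational.Unnormalised.Base as ℚᵘ using (mkℚᵘ; *≡*; *≤*)
import Data.Rational.Unnormalised.Properties as ℚᵘ
open import Data.Sum.Base using (_⊎_; inj₁; inj₂)
open import Data.Unit.Base using (tt)
open import Function.Base using (_∘_)
open import Function.Bundles using (_⇔_; mk⇔; Equivalence)
open import Induction.WellFounded using (Acc; acc)
open import Relation.Binary.PropositionalEquality
open import Relation.Nullary using (yes; no; contradiction)
open import Relation.Nullary.Decidable using (from-yes)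

open Equivalence using (to; from)

-- Universality

-- The factors of the leaf bound come from the recursions. V at `t + 1` is two copies of V at `t`
-- around a U with smaller `k`: up to a weight 2 per step this is Pascal's rule, whence the binomial
-- coefficient. U gains two copies of V for each unit of `h`, so its leaves are a sum over heights
-- of terms of order `h^(k-1) / (k-1)!`; such a sum is at most `h^k / k!`, and the doubled V
-- accounts for the further `2^k`. A separate obstacle is the asserted equality of two bounds, one
-- of which has a real exponent given only by the rationals above it. One direction is transitivity.
-- The other needs a rational power of `n` that separates two unequal numbers. It is found without
-- logarithms: high powers widen any gap beyond a factor `n`, and some power of `n` must then fall
-- inside.

children : Tree → List Tree
children ⟨ Ts ⟩ = Ts

-- `_·_` computes only when both roots are visible, which `V k t h` with a variable `t` never shows.
-- Matching on the trees here keeps this out of the main induction.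
·-embedˡ : ∀ {As} S {R} → Sublist _↪_ As (children S) → Sublist _↪_ As (children (S · R))
·-embedˡ ⟨ _ ⟩ {⟨ _ ⟩} = ++ʳ _

·-embed : ∀ {Ts As A Bs T} S R → Ts ≡ As ++ A ∷ Bs →
  Sublist _↪_ As (children S) → A ↪ T → Sublist _↪_ Bs (children R) →
  Sublist _↪_ Ts (children (S · ⟨ T ∷ [] ⟩ · R))
·-embed ⟨ _ ⟩ ⟨ _ ⟩ refl as a bs = ++⁺ as (a ∷ bs)

node⁺ : ∀ {Ts} U → Sublist _↪_ Ts (children U) → ⟨ Ts ⟩ ↪ U
node⁺ ⟨ _ ⟩ = node

leaves>0 : ∀ T → 0 < leaves T
leaves>0 ⟨ []     ⟩ = s≤s z≤n
leaves>0 ⟨ T ∷ Ts ⟩ = ≤-trans (leaves>0 T) (m≤m+n _ _)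

leaves*≤leaves : ∀ Ts → leaves* Ts ≤ leaves ⟨ Ts ⟩
leaves*≤leaves []      = z≤n
leaves*≤leaves (_ ∷ _) = ≤-refl

leaves*-++ : ∀ Ss Ts → leaves* (Ss ++ Ts) ≡ leaves* Ss + leaves* Ts
leaves*-++ []       Ts = refl
leaves*-++ (S ∷ Ss) Ts =
  trans (cong (λ x → leaves S + x) (leaves*-++ Ss Ts)) (sym (+-assoc (leaves S) _ _))

maximum-heights : ∀ {h} Ts → maximum (heights Ts) ≤ h → All (λ T → height T ≤ h) Ts
maximum-heights []       _ = []
maximum-heights (T ∷ Ts) p =
  m⊔n≤o⇒m≤o (height T) _ p ∷ maximum-heights Ts (m⊔n≤o⇒n≤o (height T) _ p)

maximum-strahlers : ∀ {k} Ts → maximum (strahlers Ts) ≤ k → All (λ T → strahler T ≤ k) Ts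
maximum-strahlers []       _ = []
maximum-strahlers (T ∷ Ts) p =
  m⊔n≤o⇒m≤o (strahler T) _ p ∷ maximum-strahlers Ts (m⊔n≤o⇒n≤o (strahler T) _ p)

occurrences-≡ : ∀ {m x} xs → x ≡ m → occurrences m (x ∷ xs) ≡ suc (occurrences m xs)
occurrences-≡ {m} xs eq = cong length (filter-accept (_≟ m) eq)

occurrences-≢ : ∀ {m x} xs → x ≢ m → occurrences m (x ∷ xs) ≡ occurrences m xs
occurrences-≢ {m} xs neq = cong length (filter-reject (_≟ m) neq)

module _ (m : ℕ) where

  absent : ∀ Ts → All (λ T → strahler T ≤ m) Ts → occurrences m (strahlers Ts) ≡ 0 →
           All (λ T → strahler T < m) Ts
  absent []       []       _  = []
  absent (T ∷ Ts) (p ∷ ps) eq with strahler T ≟ m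
  ... | yes s≡m = contradiction (trans (sym (occurrences-≡ (strahlers Ts) s≡m)) eq) λ ()
  ... | no  s≢m = ≤∧≢⇒< p s≢m ∷ absent Ts ps (trans (sym (occurrences-≢ (strahlers Ts) s≢m)) eq)

  unique : ∀ Ts → All (λ T → strahler T ≤ m) Ts → occurrences m (strahlers Ts) ≡ 1 →
           ∃[ As ] ∃[ T ] ∃[ Bs ] Ts ≡ As ++ T ∷ Bs ×
             All (λ T → strahler T < m) As × All (λ T → strahler T < m) Bs
  unique (T ∷ Ts) (p ∷ ps) eq with strahler T ≟ m
  ... | yes s≡m =
    [] , T , Ts , refl , [] ,
    absent Ts ps (suc-injective (trans (sym (occurrences-≡ (strahlers Ts) s≡m)) eq))
  ... | no  s≢m =
    let As , T′ , Bs , Ts≡ , as , bs =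
          unique Ts ps (trans (sym (occurrences-≢ (strahlers Ts) s≢m)) eq)
    in T ∷ As , T′ , Bs , cong (T ∷_) Ts≡ , ≤∧≢⇒< p s≢m ∷ as , bs

-- If the maximum `m` over the children is attained once, the root has number `m` and the other
-- children stay below it; otherwise the root has `m + 1`, so no child exceeds `k`.
strahler-children : ∀ {k} Ts → strahler ⟨ Ts ⟩ ≤ suc k →
  All (λ T → strahler T ≤ k) Ts ⊎
  (∃[ As ] ∃[ T ] ∃[ Bs ] Ts ≡ As ++ T ∷ Bs ×
     All (λ T → strahler T ≤ k) As × strahler T ≤ suc k × All (λ T → strahler T ≤ k) Bs)
strahler-children [] _ = inj₁ []
strahler-children {k} Ts@(_ ∷ _) s≤
  with occurrences (maximum (strahlers Ts)) (strahlers Ts) ≡ᵇ 1 in eq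
... | false = inj₁ (maximum-strahlers Ts (s≤s⁻¹ s≤))
... | true
  with As , T , Bs , Ts≡ , as , bs ←
    unique _ Ts (maximum-strahlers Ts ≤-refl) (≡ᵇ⇒≡ _ 1 (subst Bool.T (sym eq) tt))
  = inj₂ (As , T , Bs , Ts≡ , below as , T≤ , below bs)
  where
  below : ∀ {Ss} → All (λ S → strahler S < maximum (strahlers Ts)) Ss → All (λ S → strahler S ≤ k) Ss
  below = All.map (λ s< → s≤s⁻¹ (≤-trans s< s≤))
  T≤ : strahler T ≤ suc k
  T≤ = All.head (All.++⁻ʳ As (subst (All _) Ts≡ (maximum-strahlers Ts s≤)))

strahlerNode≤ : ∀ xs → strahlerNode xs ≤ suc (maximum xs)
strahlerNode≤ [] = ≤-refl
strahlerNode≤ xs@(_ ∷ _) with occurrences (maximum xs) xs ≡ᵇ 1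
... | true  = n≤1+n _
... | false = ≤-refl

strahler>0 : ∀ T → 0 < strahler T
strahler>0 ⟨ [] ⟩ = s≤s z≤n
strahler>0 ⟨ T ∷ Ts ⟩ with occurrences (maximum (strahlers (T ∷ Ts))) (strahlers (T ∷ Ts)) ≡ᵇ 1
... | true  = ≤-trans (strahler>0 T) (m≤m⊔n _ _)
... | false = s≤s z≤n

no-strahler-0 : ∀ {Ts} → All (λ T → strahler T ≤ 0) Ts → Ts ≡ []
no-strahler-0 []                   = refl
no-strahler-0 (_∷_ {x = T} s≤0 _) = contradiction s≤0 (<⇒≱ (strahler>0 T))

mutual
  -- Settles the diagonal `h = k` of U, where the tree is just V and has no child reserved for a
  -- large Strahler number: the height alone keeps the Strahler numbers of the children small enough
  -- for V.
  strahler≤height : ∀ T → strahler T ≤ height T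
  strahler≤height ⟨ Ts ⟩ = ≤-trans (strahlerNode≤ (strahlers Ts)) (s≤s (strahlers≤heights Ts))

  strahlers≤heights : ∀ Ts → maximum (strahlers Ts) ≤ maximum (heights Ts)
  strahlers≤heights []       = z≤n
  strahlers≤heights (T ∷ Ts) = ⊔-mono-≤ (strahler≤height T) (strahlers≤heights Ts)

strahlerNode-[_] : ∀ x → strahlerNode (x ∷ []) ≡ x
strahlerNode-[ x ] rewrite ⊔-identityʳ x | occurrences-≡ {x} [] refl = refl

one-leaf : ∀ {Ts} → leaves* Ts < 2 → Ts ≡ [] ⊎ (∃[ T ] Ts ≡ T ∷ [] × leaves T < 2)
one-leaf {[]}          _ = inj₁ refl
one-leaf {T ∷ []}      p = inj₂ (T , refl , ≤-trans (s≤s (m≤m+n _ _)) p)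
one-leaf {S ∷ T ∷ Ts} p =
  contradiction p (≤⇒≯ (+-mono-≤ (leaves>0 S) (≤-trans (leaves>0 T) (m≤m+n _ _))))

-- Such a tree is a path. At `t = 0` the trees U and V lower `k` in their only child, and this
-- supplies the Strahler bound required there.
strahler-one-leaf : ∀ T → leaves T < 2 → strahler T ≤ 1
strahler-one-leaf ⟨ [] ⟩          _ = ≤-refl
strahler-one-leaf ⟨ T ∷ [] ⟩      p =
  ≤-trans (≤-reflexive strahlerNode-[ strahler T ])
          (strahler-one-leaf T (≤-trans (s≤s (m≤m+n _ _)) p))
strahler-one-leaf ⟨ S ∷ T ∷ Ts ⟩ p with one-leaf {S ∷ T ∷ Ts} p
... | inj₁ ()
... | inj₂ (_ , () , _)

-- The pivot contains the m-th leaf.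
pivot : ∀ m Ts → 0 < m →
  leaves* Ts < m ⊎
  (∃[ As ] ∃[ T ] ∃[ Bs ] Ts ≡ As ++ T ∷ Bs × leaves* As < m × m ≤ leaves* As + leaves T)
pivot m []       0<m = inj₁ 0<m
pivot m (T ∷ Ts) 0<m with <-≤-connex (leaves T) m
... | inj₂ m≤l = inj₂ ([] , T , Ts , refl , 0<m , m≤l)
... | inj₁ l<m with pivot (m ∸ leaves T) Ts (m<n⇒0<n∸m l<m)
...   | inj₁ p = inj₁ (≤-trans (+-monoʳ-< (leaves T) p) (≤-reflexive (m+[n∸m]≡n (<⇒≤ l<m))))
...   | inj₂ (As , T′ , Bs , Ts≡ , p , q) =
  inj₂ (T ∷ As , T′ , Bs , cong (T ∷_) Ts≡
       , ≤-trans (+-monoʳ-< (leaves T) p) (≤-reflexive (m+[n∸m]≡n (<⇒≤ l<m)))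
       , ≤-trans (m≤n+m∸n m (leaves T))
           (≤-trans (+-monoʳ-≤ (leaves T) q) (≤-reflexive (sym (+-assoc (leaves T) _ _)))))

module _ {Ts : List Tree} {T : Tree} {Bs : List Tree} (As : List Tree) (Ts≡ : Ts ≡ As ++ T ∷ Bs) where

  private
    total : leaves* As + (leaves T + leaves* Bs) ≡ leaves* Ts
    total = trans (sym (leaves*-++ As (T ∷ Bs))) (cong leaves* (sym Ts≡))

  part₁ : leaves* As ≤ leaves* Ts
  part₁ = ≤-trans (m≤m+n _ _) (≤-reflexive total)

  part₂ : leaves T ≤ leaves* Ts
  part₂ = ≤-trans (≤-trans (m≤m+n _ _) (m≤n+m _ (leaves* As))) (≤-reflexive total)

  part₃ : leaves* Bs ≤ leaves* Ts
  part₃ = ≤-trans (≤-trans (m≤n+m _ (leaves T)) (m≤n+m _ (leaves* As))) (≤-reflexive total)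

Fits : (k h : ℕ) → Tree → Set
Fits k h T = height T ≤ h × strahler T ≤ k

mutual
  -- U passes its full leaf budget `2 ^ suc t` to every part and makes progress in `h` or by turning
  -- to V; only V halves the budget, and its middle child, which keeps it, has smaller `k`.
  U-universal : ∀ k t h → k ≤ h → ∀ T → leaves T < 2 ^ suc t → Fits (suc k) (suc h) T →
                T ↪ U (suc k) t (suc h)
  U-universal k t h k≤h ⟨ [] ⟩ _ _ = trivial
  U-universal zero t zero k≤h ⟨ Ts@(⟨ _ ⟩ ∷ _) ⟩ l< (h≤ , _) =
    contradiction (All.head (maximum-heights Ts (s≤s⁻¹ h≤))) λ ()
  -- A Strahler number of at least 1 for every tree leaves nothing on either side of the
  -- distinguished child, so the root has a single child.
  U-universal zero t (suc h) k≤h ⟨ Ts@(T ∷ _) ⟩ l< (h≤ , s≤) with strahler-children Ts s≤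
  ... | inj₁ none with () ← no-strahler-0 none
  ... | inj₂ (As , S , Bs , Ts≡ , as , s , bs)
    with refl ← no-strahler-0 as | refl ← no-strahler-0 bs | refl ← Ts≡ =
    node (U-universal zero t h z≤n S (≤-trans (s≤s (m≤m+n _ _)) l<)
           (≤-trans (m≤m⊔n (height S) _) (s≤s⁻¹ h≤) , s) ∷ [])
  U-universal (suc k) zero (suc h) (s≤s k≤h) ⟨ Ts@(_ ∷ _) ⟩ l< (h≤ , s≤) with one-leaf {Ts} l<
  ... | inj₂ (T , refl , l<′) =
    node (U-universal k zero h k≤h T l<′
           (≤-trans (m≤m⊔n (height T) _) (s≤s⁻¹ h≤) , ≤-trans (strahler-one-leaf T l<′) (s≤s z≤n)) ∷ [])
  U-universal (suc k) (suc t) (suc h) (s≤s k≤h) ⟨ Ts@(_ ∷ _) ⟩ l< (h≤ , s≤)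
    with hs ← maximum-heights Ts (s≤s⁻¹ h≤) | h ≡ᵇ k in eq
  ... | true with refl ← ≡ᵇ⇒≡ h k (subst Bool.T (sym eq) tt) =
    node⁺ (V (2 + k) (suc t) (2 + h))
      (V-universal k (suc t) h k≤h Ts l<
        (All.map (λ {T} p → p , ≤-trans (strahler≤height T) p) hs))
  ... | false with strahler-children Ts s≤
  ...   | inj₁ all =
    node⁺ (W · ⟨ U (2 + k) (suc t) (suc h) ∷ [] ⟩ · W)
      (·-embedˡ W (V-universal k (suc t) h k≤h Ts l< (All.zip (hs , all))))
    where W = V (2 + k) (suc t) (2 + h)
  ...   | inj₂ (As , T , Bs , Ts≡ , as , s , bs)
    with Aₕ , T≤ ∷ Bₕ ← All.++⁻ As (subst (All _) Ts≡ hs) =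
    node⁺ (W · ⟨ U (2 + k) (suc t) (suc h) ∷ [] ⟩ · W)
      (·-embed W W Ts≡
          (V-universal k (suc t) h k≤h As (≤-trans (s≤s (part₁ As Ts≡)) l<) (All.zip (Aₕ , as)))
          (U-universal (suc k) (suc t) h k<h T (≤-trans (s≤s (part₂ As Ts≡)) l<) (T≤ , s))
          (V-universal k (suc t) h k≤h Bs (≤-trans (s≤s (part₃ As Ts≡)) l<) (All.zip (Bₕ , bs))))
    where
    W = V (2 + k) (suc t) (2 + h)
    k<h : k < h
    k<h = ≤∧≢⇒< k≤h λ { refl → subst Bool.T eq (≡⇒≡ᵇ h h refl) }

  V-universal : ∀ k t h → k ≤ h → ∀ Ts → leaves* Ts < 2 ^ suc t → All (Fits (suc k) (suc h)) Ts →
                Sublist _↪_ Ts (children (V (2 + k) t (2 + h)))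
  V-universal k zero h k≤h Ts l< fits with one-leaf {Ts} l<
  ... | inj₁ refl = minimum _
  ... | inj₂ (T , refl , l<′) = U-universal k zero h k≤h T l<′ (All.head fits) ∷ []
  -- The pivot holds leaf number `2 ^ suc t`: fewer than that many leaves precede it, and fewer
  -- follow it because the total is below twice that number. Without a pivot the whole list fits
  -- into the left copy.
  V-universal k (suc t) h k≤h Ts l< fits with pivot (2 ^ suc t) Ts (m^n>0 2 (suc t))
  ... | inj₁ p = ·-embedˡ (V (2 + k) t (2 + h)) (V-universal k t h k≤h Ts p fits)
  ... | inj₂ (As , T , Bs , Ts≡ , As< , ≤AsT)
    with Aᶠ , Tᶠ ∷ Bᶠ ← All.++⁻ As (subst (All _) Ts≡ fits) =
    ·-embed (V (2 + k) t (2 + h)) (V (2 + k) t (2 + h)) Ts≡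
        (V-universal k t h k≤h As As< Aᶠ)
        (U-universal k (suc t) h k≤h T (≤-trans (s≤s (part₂ As Ts≡)) l<) Tᶠ)
        (V-universal k t h k≤h Bs Bs< Bᶠ)
    where
    open ≤-Reasoning
    Bs< : leaves* Bs < 2 ^ suc t
    Bs< = +-cancelˡ-< (2 ^ suc t) _ _ (begin-strict
      2 ^ suc t + leaves* Bs              ≤⟨ +-monoˡ-≤ _ ≤AsT ⟩
      leaves* As + leaves T + leaves* Bs  ≡⟨ +-assoc (leaves* As) _ _ ⟩
      leaves* As + leaves* (T ∷ Bs)       ≡⟨ leaves*-++ As (T ∷ Bs) ⟨
      leaves* (As ++ T ∷ Bs)              ≡⟨ cong leaves* Ts≡ ⟨
      leaves* Ts                          <⟨ l< ⟩
      2 ^ (2 + t)                         ≡⟨ cong (λ x → 2 ^ suc t + x) (+-identityʳ _) ⟩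
      2 ^ suc t + 2 ^ suc t               ∎)

-- The integer part of the binary logarithm

-- `⌊log2⌋` recurses on its accessibility argument, so the induction follows that argument and must
-- hold for an arbitrary one.
2^⌊log2⌋≤ : ∀ n (ac : Acc _<_ (suc n)) → 2 ^ ⌊log2⌋ (suc n) ac ≤ suc n
2^⌊log2⌋≤ zero    _        = ≤-refl
2^⌊log2⌋≤ (suc n) (acc rs) = begin
  2 * 2 ^ ⌊log2⌋ (suc ⌊ n /2⌋) _       ≤⟨ *-monoʳ-≤ 2 (2^⌊log2⌋≤ ⌊ n /2⌋ _) ⟩
  2 * suc ⌊ n /2⌋                      ≡⟨ *-suc 2 ⌊ n /2⌋ ⟩
  2 + (⌊ n /2⌋ + (⌊ n /2⌋ + 0))        ≡⟨ cong (λ m → 2 + (⌊ n /2⌋ + m)) (+-identityʳ _) ⟩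
  2 + (⌊ n /2⌋ + ⌊ n /2⌋)              ≤⟨ +-monoʳ-≤ 2 (+-monoʳ-≤ ⌊ n /2⌋ (⌊n/2⌋≤⌈n/2⌉ n)) ⟩
  2 + (⌊ n /2⌋ + ⌈ n /2⌉)              ≡⟨ cong (λ x → 2 + x) (⌊n/2⌋+⌈n/2⌉≡n n) ⟩
  2 + n                                ∎
  where open ≤-Reasoning

2^⌊log₂n⌋≤n : ∀ {n} → 0 < n → 2 ^ ⌊log₂ n ⌋ ≤ n
2^⌊log₂n⌋≤n {suc n} _ = 2^⌊log2⌋≤ n (<-wellFounded _)

n<2^[1+⌊log₂n⌋] : ∀ n → n < 2 ^ suc ⌊log₂ n ⌋
n<2^[1+⌊log₂n⌋] n = ≰⇒> λ p → 1+n≰n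
  (≤-trans (≤-reflexive (sym (⌊log₂[2^n]⌋≡n (suc ⌊log₂ n ⌋)))) (⌊log₂⌋-mono-≤ p))

U-StrahlerUniversal : ∀ n h k .{{_ : NonZero k}} → k ≤ h → StrahlerUniversal k n h (U k ⌊log₂ n ⌋ h)
U-StrahlerUniversal n (suc h) (suc k) (s≤s k≤h) T (l≤ , h≤) s≤ =
  U-universal k ⌊log₂ n ⌋ h k≤h T (≤-trans (s≤s l≤) (n<2^[1+⌊log₂n⌋] n)) (h≤ , s≤)

-- Counting leaves

^-distribʳ-* : ∀ m n o → (m * n) ^ o ≡ m ^ o * n ^ o
^-distribʳ-* m n zero    = refl
^-distribʳ-* m n (suc o) = begin
  m * n * (m * n) ^ o       ≡⟨ cong (m * n *_) (^-distribʳ-* m n o) ⟩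
  m * n * (m ^ o * n ^ o)   ≡⟨ [m*n]*[o*p]≡[m*o]*[n*p] m n (m ^ o) (n ^ o) ⟩
  m * m ^ o * (n * n ^ o)   ∎
  where open ≡-Reasoning

-- Two terms of the binomial expansion of the right side. It serves to sum `h^k` over `h`, to
-- compare consecutive values of (1 + 1/k)^(k+1), and to widen a gap in `separate`.
bernoulli : ∀ a n → suc n * a ^ n + a ^ suc n ≤ suc a ^ suc n
bernoulli a zero    = ≤-refl
bernoulli a (suc n) = begin
  suc (suc n) * a ^ suc n + a ^ suc (suc n)  ≤⟨ m≤m+n _ (suc n * a ^ n) ⟩
  suc (suc n) * (a * a ^ n) + a * (a * a ^ n) + suc n * a ^ n
                                             ≡⟨ lemma a n (a ^ n) ⟩
  suc a * (suc n * a ^ n + a ^ suc n)        ≤⟨ *-monoʳ-≤ (suc a) (bernoulli a n) ⟩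
  suc a ^ suc (suc n)                        ∎
  where
  open ≤-Reasoning
  lemma : ∀ a n p → suc (suc n) * (a * p) + a * (a * p) + suc n * p ≡
                    suc a * (suc n * p + a * p)
  lemma = solve-∀

-- multichoose t k = C(t + k, k)
multichoose : ℕ → ℕ → ℕ
multichoose t       zero    = 1
multichoose zero    (suc k) = 1
multichoose (suc t) (suc k) = multichoose t (suc k) + multichoose (suc t) k

multichoose-0 : ∀ k → multichoose 0 k ≡ 1
multichoose-0 zero    = refl
multichoose-0 (suc k) = refl

multichoose≤2^ : ∀ t k → multichoose t k ≤ 2 ^ (t + k)
multichoose≤2^ t       zero    = m^n>0 2 (t + 0)
multichoose≤2^ zero    (suc k) = m^n>0 2 (suc k)
multichoose≤2^ (suc t) (suc k) = begin
  multichoose t (suc k) + multichoose (suc t) k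
    ≤⟨ +-mono-≤ (multichoose≤2^ t (suc k)) (multichoose≤2^ (suc t) k) ⟩
  2 ^ (t + suc k) + 2 ^ suc (t + k)
    ≡⟨ cong (λ e → 2 ^ (t + suc k) + 2 ^ e) (+-suc t k) ⟨
  2 ^ (t + suc k) + 2 ^ (t + suc k)
    ≡⟨ cong (λ x → 2 ^ (t + suc k) + x) (+-identityʳ _) ⟨
  2 ^ suc (t + suc k) ∎
  where open ≤-Reasoning

multichoose≤^ : ∀ t k → multichoose t k ≤ suc t ^ k
multichoose≤^ t       zero    = ≤-refl
multichoose≤^ zero    (suc k) = m^n>0 1 (suc k)
multichoose≤^ (suc t) (suc k) = begin
  multichoose t (suc k) + multichoose (suc t) k
    ≤⟨ +-mono-≤ (multichoose≤^ t (suc k)) (multichoose≤^ (suc t) k) ⟩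
  suc t * suc t ^ k + suc (suc t) ^ k
    ≤⟨ +-monoˡ-≤ _ (*-monoʳ-≤ (suc t) (^-monoˡ-≤ k (n≤1+n (suc t)))) ⟩
  suc t * suc (suc t) ^ k + suc (suc t) ^ k
    ≡⟨ +-comm (suc t * suc (suc t) ^ k) _ ⟩
  suc (suc t) ^ suc k ∎
  where open ≤-Reasoning

-- Only an inequality, since the trivial tree counts as one leaf but contributes no child to the
-- merged root.
leaves-· : ∀ S T → leaves (S · T) ≤ leaves S + leaves T
leaves-· ⟨ [] ⟩     ⟨ _ ⟩  = n≤1+n _
leaves-· ⟨ S ∷ Ss ⟩ ⟨ Ts ⟩ = begin
  leaves S + leaves* (Ss ++ Ts)          ≡⟨ cong (λ x → leaves S + x) (leaves*-++ Ss Ts) ⟩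
  leaves S + (leaves* Ss + leaves* Ts)   ≡⟨ +-assoc (leaves S) _ _ ⟨
  leaves S + leaves* Ss + leaves* Ts     ≤⟨ +-monoʳ-≤ _ (leaves*≤leaves Ts) ⟩
  leaves S + leaves* Ss + leaves ⟨ Ts ⟩  ∎
  where open ≤-Reasoning

leaves-sandwich : ∀ S T → leaves (S · ⟨ T ∷ [] ⟩ · S) ≤ 2 * leaves S + leaves T
leaves-sandwich S T = begin
  leaves (S · ⟨ T ∷ [] ⟩ · S)               ≤⟨ leaves-· S _ ⟩
  leaves S + leaves (⟨ T ∷ [] ⟩ · S)        ≤⟨ +-monoʳ-≤ (leaves S) (leaves-· ⟨ T ∷ [] ⟩ S) ⟩
  leaves S + (leaves T + 0 + leaves S)      ≡⟨ lemma (leaves S) (leaves T) ⟩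
  2 * leaves S + leaves T                   ∎
  where
  open ≤-Reasoning
  lemma : ∀ s t → s + (t + 0 + s) ≡ 2 * s + t
  lemma = solve-∀

leaves-U₁ : ∀ t h → leaves (U 1 t (suc h)) ≡ 1
leaves-U₁ t zero    = refl
leaves-U₁ t (suc h) = trans (+-identityʳ _) (leaves-U₁ t h)

mutual
  -- A step in `h` adds two copies of V. Their number supplies the extra factor 2 that U has over V,
  -- and by `bernoulli` the rest is at most the growth of the power of the height. Keeping `k !` on
  -- the left avoids division.
  leaves-U : ∀ k t h → k ≤ h →
    leaves (U (suc k) t (suc h)) * k ! ≤ 2 ^ (t + k) * multichoose t k * suc h ^ k
  leaves-U zero t h _ rewrite leaves-U₁ t h | *-identityʳ (2 ^ (t + 0) * 1) | *-identityʳ (2 ^ (t + 0)) =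
    m^n>0 2 (t + 0)
  leaves-U (suc k) zero (suc h) (s≤s k≤h) = begin
    (u + 0) * (suc k * k !)                          ≡⟨ lemma₁ u (suc k) (k !) ⟩
    suc k * (u * k !)                                ≤⟨ *-monoʳ-≤ (suc k) (leaves-U k 0 h k≤h) ⟩
    suc k * (2 ^ k * multichoose 0 k * suc h ^ k)    ≡⟨ cong (λ m → suc k * (2 ^ k * m * suc h ^ k)) (multichoose-0 k) ⟩
    suc k * (2 ^ k * 1 * suc h ^ k)
      ≤⟨ *-mono-≤ (≤-trans (s≤s k≤h) (n≤1+n _)) (*-mono-≤ (*-monoˡ-≤ 1 (^-monoʳ-≤ 2 (n≤1+n k))) (^-monoˡ-≤ k (n≤1+n _))) ⟩
    suc (suc h) * (2 ^ suc k * 1 * suc (suc h) ^ k)  ≡⟨ lemma₂ (suc (suc h)) (2 ^ suc k * 1) _ ⟩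
    2 ^ suc k * 1 * suc (suc h) ^ suc k              ∎
    where
    open ≤-Reasoning
    u = leaves (U (suc k) 0 (suc h))
    lemma₁ : ∀ u k f → (u + 0) * (k * f) ≡ k * (u * f)
    lemma₁ = solve-∀
    lemma₂ : ∀ a b c → a * (b * c) ≡ b * (a * c)
    lemma₂ = solve-∀
  leaves-U (suc k) (suc t) (suc h) (s≤s k≤h) with h ≡ᵇ k in eq
  ... | true = begin
    v * (suc k * k !)                                ≡⟨ lemma₁ v (suc k) (k !) ⟩
    suc k * (v * k !)                                ≤⟨ *-monoʳ-≤ (suc k) (leaves-V k (suc t) h k≤h) ⟩
    suc k * (2 ^ (suc t + k) * m * suc h ^ k)        ≡⟨ lemma₂ (suc k) (2 ^ (suc t + k) * m) (suc h ^ k) ⟩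
    -- On the diagonal there is no middle child to add, so the first term of `bernoulli` is enough.
    2 ^ (suc t + k) * m * (suc k * suc h ^ k)
      ≤⟨ *-mono-≤ (*-monoˡ-≤ m (^-monoʳ-≤ 2 (+-monoʳ-≤ (suc t) (n≤1+n k))))
           (≤-trans (m≤m+n _ _) (bernoulli (suc h) k)) ⟩
    2 ^ (suc t + suc k) * m * suc (suc h) ^ suc k    ∎
    where
    open ≤-Reasoning
    v = leaves (V (2 + k) (suc t) (2 + h))
    m = multichoose (suc t) (suc k)
    lemma₁ : ∀ u k f → u * (k * f) ≡ k * (u * f)
    lemma₁ = solve-∀
    lemma₂ : ∀ a b c → a * (b * c) ≡ b * (a * c)
    lemma₂ = solve-∀
  ... | false = begin
    leaves (W · ⟨ U (2 + k) (suc t) (suc h) ∷ [] ⟩ · W) * (suc k) !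
      ≤⟨ *-monoˡ-≤ (suc k !) (leaves-sandwich W (U (2 + k) (suc t) (suc h))) ⟩
    (2 * v + u) * (suc k * k !)
      ≡⟨ lemma₁ v u (suc k) (k !) ⟩
    2 * suc k * (v * k !) + u * (suc k !)
      ≤⟨ +-mono-≤ (*-monoʳ-≤ (2 * suc k) (leaves-V k (suc t) h k≤h)) (leaves-U (suc k) (suc t) h k<h) ⟩
    2 * suc k * (2 ^ (suc t + k) * m * suc h ^ k) + 2 ^ (suc t + suc k) * m * suc h ^ suc k
      ≡⟨ cong (λ e → 2 * suc k * (2 ^ (suc t + k) * m * suc h ^ k) + 2 ^ e * m * suc h ^ suc k) (+-suc (suc t) k) ⟩
    2 * suc k * (2 ^ (suc t + k) * m * suc h ^ k) + 2 * 2 ^ (suc t + k) * m * suc h ^ suc k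
      ≡⟨ lemma₂ (2 ^ (suc t + k)) m (suc k) (suc h ^ k) (suc h ^ suc k) ⟩
    2 * 2 ^ (suc t + k) * m * (suc k * suc h ^ k + suc h ^ suc k)
      ≡⟨ cong (λ e → 2 ^ e * m * (suc k * suc h ^ k + suc h ^ suc k)) (+-suc (suc t) k) ⟨
    2 ^ (suc t + suc k) * m * (suc k * suc h ^ k + suc h ^ suc k)
      ≤⟨ *-monoʳ-≤ (2 ^ (suc t + suc k) * m) (bernoulli (suc h) k) ⟩
    2 ^ (suc t + suc k) * m * suc (suc h) ^ suc k  ∎
    where
    open ≤-Reasoning
    W = V (2 + k) (suc t) (2 + h)
    v = leaves W
    u = leaves (U (2 + k) (suc t) (suc h))
    m = multichoose (suc t) (suc k)
    k<h : k < h
    k<h = ≤∧≢⇒< k≤h λ { refl → subst Bool.T eq (≡⇒≡ᵇ h h refl) }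
    lemma₁ : ∀ v u k f → (2 * v + u) * (k * f) ≡ 2 * k * (v * f) + u * (k * f)
    lemma₁ = solve-∀
    lemma₂ : ∀ p m k a b → 2 * k * (p * m * a) + 2 * p * m * b ≡ 2 * p * m * (k * a + b)
    lemma₂ = solve-∀

  -- Compared with U at the same parameters, one factor 2 and one power of the height are saved,
  -- which is what `leaves-U` spends. The step in `t` is the recursion of `multichoose`, weighted by
  -- 2.
  leaves-V : ∀ k t h → k ≤ h →
    leaves (V (2 + k) t (2 + h)) * k ! ≤ 2 ^ (t + k) * multichoose t (suc k) * suc h ^ k
  leaves-V k zero h k≤h = begin
    (leaves (U (suc k) 0 (suc h)) + 0) * k !  ≡⟨ cong (_* k !) (+-identityʳ (leaves (U (suc k) 0 (suc h)))) ⟩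
    leaves (U (suc k) 0 (suc h)) * k !        ≤⟨ leaves-U k 0 h k≤h ⟩
    2 ^ k * multichoose 0 k * suc h ^ k       ≡⟨ cong (λ m → 2 ^ k * m * suc h ^ k) (multichoose-0 k) ⟩
    2 ^ k * 1 * suc h ^ k                     ∎
    where open ≤-Reasoning
  leaves-V k (suc t) h k≤h = begin
    leaves (V (2 + k) (suc t) (2 + h)) * k !
      ≤⟨ *-monoˡ-≤ (k !) (leaves-sandwich (V (2 + k) t (2 + h)) (U (suc k) (suc t) (suc h))) ⟩
    (2 * v + u) * k !
      ≡⟨ lemma₁ v u (k !) ⟩
    2 * (v * k !) + u * k !
      ≤⟨ +-mono-≤ (*-monoʳ-≤ 2 (leaves-V k t h k≤h)) (leaves-U k (suc t) h k≤h) ⟩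
    2 * (2 ^ (t + k) * multichoose t (suc k) * suc h ^ k) +
    2 * 2 ^ (t + k) * multichoose (suc t) k * suc h ^ k
      ≡⟨ lemma₂ (2 ^ (t + k)) (multichoose t (suc k)) (multichoose (suc t) k) (suc h ^ k) ⟩
    2 ^ (suc t + k) * multichoose (suc t) (suc k) * suc h ^ k ∎
    where
    open ≤-Reasoning
    v = leaves (V (2 + k) t (2 + h))
    u = leaves (U (suc k) (suc t) (suc h))
    lemma₁ : ∀ v u f → (2 * v + u) * f ≡ 2 * (v * f) + u * f
    lemma₁ = solve-∀
    lemma₂ : ∀ p a b x → 2 * (p * a * x) + 2 * p * b * x ≡ 2 * p * (a + b) * x
    lemma₂ = solve-∀

-- Bounding k^k / k! by a power of a rational above e

-- Put m = k(k+2) = (k+1)² - 1. After division the claim is (1 + 1/m)^(k+1) ≥ 1 + 1/(k+1).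
-- Bernoulli's inequality gives 1 + (k+1)/m on the left, and (k+1)² > m. The factor `m` is
-- multiplied in to avoid the division.
[1+1/k]^[1+k]-decreasing : ∀ k .{{_ : NonZero k}} →
  (2 + k) ^ (2 + k) * k ^ (1 + k) ≤ (1 + k) ^ (2 + k) * (1 + k) ^ (1 + k)
[1+1/k]^[1+k]-decreasing k = *-cancelʳ-≤ _ _ (k * (2 + k)) (begin
  (2 + k) ^ (2 + k) * k ^ (1 + k) * (k * (2 + k))
    ≡⟨ lemma₁ (2 + k) ((2 + k) ^ (1 + k)) (k ^ (1 + k)) (k * (2 + k)) ⟩
  k ^ (1 + k) * (2 + k) ^ (1 + k) * ((2 + k) * (k * (2 + k)))
    ≡⟨ cong (_* ((2 + k) * (k * (2 + k)))) (^-distribʳ-* k (2 + k) (1 + k)) ⟨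
  m ^ (1 + k) * ((2 + k) * (k * (2 + k)))
    ≤⟨ *-monoʳ-≤ (m ^ (1 + k)) (≤-trans (n≤1+n _) (≤-reflexive (lemma₂ k))) ⟩
  m ^ (1 + k) * ((1 + k) * (m + (1 + k)))
    ≡⟨ lemma₃ m (m ^ k) (1 + k) ⟩
  (1 + k) * (m * ((1 + k) * m ^ k + m ^ (1 + k)))
    ≤⟨ *-monoʳ-≤ (1 + k) (*-monoʳ-≤ m (bernoulli m k)) ⟩
  (1 + k) * (m * (1 + m) ^ (1 + k))
    ≡⟨ cong (λ x → (1 + k) * (m * x ^ (1 + k))) (lemma₄ k) ⟩
  (1 + k) * (m * ((1 + k) * (1 + k)) ^ (1 + k))
    ≡⟨ cong (λ x → (1 + k) * (m * x)) (^-distribʳ-* (1 + k) (1 + k) (1 + k)) ⟩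
  (1 + k) * (m * ((1 + k) ^ (1 + k) * (1 + k) ^ (1 + k)))
    ≡⟨ lemma₅ (1 + k) m ((1 + k) ^ (1 + k)) ⟩
  (1 + k) ^ (2 + k) * (1 + k) ^ (1 + k) * (k * (2 + k)) ∎)
  where
  open ≤-Reasoning
  m = k * (2 + k)
  instance _ = m*n≢0 k (2 + k)
  lemma₁ : ∀ a b c d → a * b * c * d ≡ c * b * (a * d)
  lemma₁ = solve-∀
  lemma₂ : ∀ k → 1 + (2 + k) * (k * (2 + k)) ≡ (1 + k) * (k * (2 + k) + (1 + k))
  lemma₂ = solve-∀
  lemma₃ : ∀ m p k → m * p * (k * (m + k)) ≡ k * (m * (k * p + m * p))
  lemma₃ = solve-∀
  lemma₄ : ∀ k → 1 + k * (2 + k) ≡ (1 + k) * (1 + k)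
  lemma₄ = solve-∀
  lemma₅ : ∀ k m a → k * (m * (a * a)) ≡ k * a * a * m
  lemma₅ = solve-∀

-- Because (1 + 1/k)^(k+1) decreases, one numerical check at `k₀` covers all later `k`. The
-- companion (1 + 1/k)^k increases to e and would not allow this.
[1+1/k]^[1+k]-bound : ∀ p q k₀ .{{_ : NonZero k₀}} → (1 + k₀) ^ (1 + k₀) * q ≤ p * k₀ ^ (1 + k₀) →
  ∀ d → let k = d + k₀ in (1 + k) ^ (1 + k) * q ≤ p * k ^ (1 + k)
[1+1/k]^[1+k]-bound p q k₀ base zero    = base
[1+1/k]^[1+k]-bound p q k₀ base (suc d) = *-cancelʳ-≤ _ _ (k ^ (1 + k)) (begin
  (2 + k) ^ (2 + k) * q * k ^ (1 + k)
    ≡⟨ lemma₁ ((2 + k) ^ (2 + k)) q (k ^ (1 + k)) ⟩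
  (2 + k) ^ (2 + k) * k ^ (1 + k) * q
    ≤⟨ *-monoˡ-≤ q ([1+1/k]^[1+k]-decreasing k) ⟩
  (1 + k) ^ (2 + k) * (1 + k) ^ (1 + k) * q
    ≡⟨ *-assoc ((1 + k) ^ (2 + k)) _ q ⟩
  (1 + k) ^ (2 + k) * ((1 + k) ^ (1 + k) * q)
    ≤⟨ *-monoʳ-≤ ((1 + k) ^ (2 + k)) ([1+1/k]^[1+k]-bound p q k₀ base d) ⟩
  (1 + k) ^ (2 + k) * (p * k ^ (1 + k))
    ≡⟨ lemma₂ ((1 + k) ^ (2 + k)) p (k ^ (1 + k)) ⟩
  p * (1 + k) ^ (2 + k) * k ^ (1 + k) ∎)
  where
  open ≤-Reasoning
  k = d + k₀
  instance
    k≢0 : NonZero k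
    k≢0 = >-nonZero (≤-trans (>-nonZero⁻¹ k₀) (m≤n+m k₀ d))
    _ = m^n≢0 k (1 + k)
  lemma₁ : ∀ a b c → a * b * c ≡ a * c * b
  lemma₁ = solve-∀
  lemma₂ : ∀ a b c → a * (b * c) ≡ b * a * c
  lemma₂ = solve-∀

^-comm : ∀ m a b → (m ^ a) ^ b ≡ (m ^ b) ^ a
^-comm m a b = trans (^-*-assoc m a b) (trans (cong (m ^_) (*-comm a b)) (sym (^-*-assoc m b a)))

-- Passing from k to k+1 multiplies k^k / k! by (1 + 1/k)^k ≤ (1 + 1/k)^(k+1), which is at most p/q
-- once k ≥ k₀. Up to `k₀` the claim is left to a finite check.
k^k≤[p/q]^k*k! : ∀ p q k₀ .{{_ : NonZero k₀}} →
  (∀ {k} → k < 1 + k₀ → k ^ k * q ^ k ≤ p ^ k * k !) →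
  (1 + k₀) ^ (1 + k₀) * q ≤ p * k₀ ^ (1 + k₀) →
  ∀ k → k ^ k * q ^ k ≤ p ^ k * k !
k^k≤[p/q]^k*k! p q k₀ small base zero    = ≤-refl
k^k≤[p/q]^k*k! p q k₀ small base (suc k) with <-≤-connex k k₀
... | inj₁ k<k₀ = small (s≤s k<k₀)
... | inj₂ k₀≤k = begin
  (1 + k) ^ (1 + k) * (q * q ^ k)    ≡⟨ *-assoc ((1 + k) ^ (1 + k)) q (q ^ k) ⟨
  (1 + k) ^ (1 + k) * q * q ^ k      ≤⟨ *-monoˡ-≤ (q ^ k) ratio ⟩
  p * (k * k ^ k) * q ^ k            ≡⟨ lemma₁ p k (k ^ k) (q ^ k) ⟩
  p * k * (k ^ k * q ^ k)            ≤⟨ *-mono-≤ (*-monoʳ-≤ p (n≤1+n k)) (k^k≤[p/q]^k*k! p q k₀ small base k) ⟩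
  p * (1 + k) * (p ^ k * k !)        ≡⟨ [m*n]*[o*p]≡[m*o]*[n*p] p (1 + k) (p ^ k) (k !) ⟩
  p ^ (1 + k) * (1 + k) !            ∎
  where
  open ≤-Reasoning
  ratio : (1 + k) ^ (1 + k) * q ≤ p * k ^ (1 + k)
  ratio = subst (λ k → (1 + k) ^ (1 + k) * q ≤ p * k ^ (1 + k)) (m∸n+n≡m k₀≤k)
            ([1+1/k]^[1+k]-bound p q k₀ base (k ∸ k₀))
  lemma₁ : ∀ p k a b → p * (k * a) * b ≡ p * k * (a * b)
  lemma₁ = solve-∀

-- e < 2.73 < 2^1.45, and 116 is the least k with (1 + 1/k)^(k+1) ≤ 2.73.
k^k≤2·73^k*k! : ∀ k → k ^ k * 100 ^ k ≤ 273 ^ k * k !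
k^k≤2·73^k*k! = k^k≤[p/q]^k*k! 273 100 116
  (λ {k} k< → ≤ᵇ⇒≤ _ _ (from-yes (allUpTo? (λ k → Bool.T? (k ^ k * 100 ^ k ≤ᵇ 273 ^ k * k !)) 117) k<))
  (≤ᵇ⇒≤ _ _ _)

-- Leaf bounds as powers of n

module LeafBounds (p q : ℕ) .{{_ : NonZero q}} (k^k≤ : ∀ k → k ^ k * q ^ k ≤ p ^ k * k !) where

  -- `w` leaves open how the binomial coefficient and the power of 2 are estimated, which differs
  -- between the three regimes of `k`. `leaves-U` speaks of (k-1)! and h^(k-1); one use of `k ≤ h`
  -- turns them into k! and h^k.
  leaves-bound : ∀ {w} k t h .{{_ : NonZero k}} → k ≤ h →
    2 ^ (t + pred k) * multichoose t (pred k) ≤ w →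
    leaves (U k t h) * k ^ k * q ^ k ≤ w * (p ^ k * h ^ k)
  leaves-bound {w} (suc k) t (suc h) (s≤s k≤h) A≤w = begin
    u * suc k ^ suc k * q ^ suc k         ≡⟨ *-assoc u _ _ ⟩
    u * (suc k ^ suc k * q ^ suc k)       ≤⟨ *-monoʳ-≤ u (k^k≤ (suc k)) ⟩
    u * (p ^ suc k * (suc k * k !))       ≡⟨ lemma₁ u (p ^ suc k) (suc k) (k !) ⟩
    p ^ suc k * suc k * (u * k !)         ≤⟨ *-mono-≤ (*-monoʳ-≤ (p ^ suc k) (s≤s k≤h)) (leaves-U k t h k≤h) ⟩
    p ^ suc k * suc h * (A * suc h ^ k)   ≡⟨ lemma₂ (p ^ suc k) (suc h) A (suc h ^ k) ⟩
    A * (p ^ suc k * suc h ^ suc k)       ≤⟨ *-monoˡ-≤ (p ^ suc k * suc h ^ suc k) A≤w ⟩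
    w * (p ^ suc k * suc h ^ suc k)       ∎
    where
    open ≤-Reasoning
    u = leaves (U (suc k) t (suc h))
    A = 2 ^ (t + k) * multichoose t k
    lemma₁ : ∀ u p k f → u * (p * (k * f)) ≡ p * k * (u * f)
    lemma₁ = solve-∀
    lemma₂ : ∀ p h a b → p * h * (a * b) ≡ a * (p * (h * b))
    lemma₂ = solve-∀

  module _ (n h k : ℕ) .{{_ : NonZero k}} (0<n : 0 < n) (k≤h : k ≤ h) where

    private
      t = ⌊log₂ n ⌋
      u = leaves (U k t h)
      instance
        n≢0 : NonZero n
        n≢0 = >-nonZero 0<n

    -- Here b/a is an upper bound of lg(p/q), so (p/q)^k ≤ (2^k)^(b/a) ≤ n^(b/a). The power `a` on
    -- both sides keeps the exponents integral.
    leaves≤n^[4+b/a] : ∀ a b → p ^ a ≤ 2 ^ b * q ^ a → k ≤ t →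
                       (u * k ^ k) ^ a ≤ n ^ (4 * a + b) * (h ^ k) ^ a
    leaves≤n^[4+b/a] a b p≤ k≤t = *-cancelʳ-≤ _ _ ((q ^ k) ^ a) {{m^n≢0 (q ^ k) a {{m^n≢0 q k}}}} (begin
      (u * k ^ k) ^ a * (q ^ k) ^ a                   ≡⟨ ^-distribʳ-* (u * k ^ k) (q ^ k) a ⟨
      (u * k ^ k * q ^ k) ^ a                         ≤⟨ ^-monoˡ-≤ a (leaves-bound k t h k≤h weight) ⟩
      (n ^ 4 * (p ^ k * h ^ k)) ^ a                   ≡⟨ ^-distribʳ-* (n ^ 4) _ a ⟩
      (n ^ 4) ^ a * (p ^ k * h ^ k) ^ a               ≡⟨ cong₂ _*_ (^-*-assoc n 4 a) (^-distribʳ-* (p ^ k) (h ^ k) a) ⟩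
      n ^ (4 * a) * ((p ^ k) ^ a * (h ^ k) ^ a)       ≤⟨ *-monoʳ-≤ (n ^ (4 * a)) (*-monoˡ-≤ _ p^ka≤) ⟩
      n ^ (4 * a) * (n ^ b * (q ^ k) ^ a * (h ^ k) ^ a)
                                                      ≡⟨ lemma (n ^ (4 * a)) (n ^ b) _ _ ⟩
      n ^ (4 * a) * n ^ b * (h ^ k) ^ a * (q ^ k) ^ a ≡⟨ cong (λ x → x * (h ^ k) ^ a * (q ^ k) ^ a) (^-distribˡ-+-* n (4 * a) b) ⟨
      n ^ (4 * a + b) * (h ^ k) ^ a * (q ^ k) ^ a     ∎)
      where
      open ≤-Reasoning
      lemma : ∀ x y z w → x * (y * z * w) ≡ x * y * w * z
      lemma = solve-∀
      2^[t+k]≤ : 2 ^ (t + pred k) ≤ n * n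
      2^[t+k]≤ = begin
        2 ^ (t + pred k)   ≤⟨ ^-monoʳ-≤ 2 (+-monoʳ-≤ t (≤-trans (pred[n]≤n {k}) k≤t)) ⟩
        2 ^ (t + t)        ≡⟨ ^-distribˡ-+-* 2 t t ⟩
        2 ^ t * 2 ^ t      ≤⟨ *-mono-≤ (2^⌊log₂n⌋≤n 0<n) (2^⌊log₂n⌋≤n 0<n) ⟩
        n * n              ∎
      weight : 2 ^ (t + pred k) * multichoose t (pred k) ≤ n ^ 4
      weight = begin
        2 ^ (t + pred k) * multichoose t (pred k)
          ≤⟨ *-mono-≤ 2^[t+k]≤ (≤-trans (multichoose≤2^ t (pred k)) 2^[t+k]≤) ⟩
        n * n * (n * n)    ≡⟨ n⁴ n ⟩
        n ^ 4              ∎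
        where
        n⁴ : ∀ n → n * n * (n * n) ≡ n * (n * (n * (n * 1)))
        n⁴ = solve-∀
      p^ka≤ : (p ^ k) ^ a ≤ n ^ b * (q ^ k) ^ a
      p^ka≤ = begin
        (p ^ k) ^ a                ≡⟨ ^-comm p k a ⟩
        (p ^ a) ^ k                ≤⟨ ^-monoˡ-≤ k p≤ ⟩
        (2 ^ b * q ^ a) ^ k        ≡⟨ ^-distribʳ-* (2 ^ b) (q ^ a) k ⟩
        (2 ^ b) ^ k * (q ^ a) ^ k  ≡⟨ cong₂ _*_ (^-comm 2 b k) (^-comm q a k) ⟩
        (2 ^ k) ^ b * (q ^ k) ^ a
          ≤⟨ *-monoˡ-≤ _ (^-monoˡ-≤ b (≤-trans (^-monoʳ-≤ 2 k≤t) (2^⌊log₂n⌋≤n 0<n))) ⟩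
        n ^ b * (q ^ k) ^ a        ∎

    -- For `k` of smaller order than lg n any constant base costs only n^o(1); the value 4 turns the
    -- factors depending on `k` into powers of 2.
    module _ (p≤ : p ≤ 4 * q) where

      private
        open ≤-Reasoning

        cancel : ∀ {w v} → 2 ^ (t + pred k) * multichoose t (pred k) ≤ w → w * 4 ^ k ≤ v →
                 u * k ^ k ≤ v * h ^ k
        cancel {w} {v} w≥ w≤ = *-cancelʳ-≤ _ _ (q ^ k) {{m^n≢0 q k}} (begin
          u * k ^ k * q ^ k            ≤⟨ leaves-bound k t h k≤h w≥ ⟩
          w * (p ^ k * h ^ k)          ≤⟨ *-monoʳ-≤ w (*-monoˡ-≤ (h ^ k) (^-monoˡ-≤ k p≤)) ⟩
          w * ((4 * q) ^ k * h ^ k)    ≡⟨ cong (λ x → w * (x * h ^ k)) (^-distribʳ-* 4 q k) ⟩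
          w * (4 ^ k * q ^ k * h ^ k)  ≡⟨ lemma w (4 ^ k) (q ^ k) (h ^ k) ⟩
          w * 4 ^ k * h ^ k * q ^ k    ≤⟨ *-monoˡ-≤ (q ^ k) (*-monoˡ-≤ (h ^ k) w≤) ⟩
          v * h ^ k * q ^ k            ∎)
          where
          lemma : ∀ w x y z → w * (x * y * z) ≡ w * x * z * y
          lemma = solve-∀

        2^[t+k]≤ : 2 ^ (t + pred k) ≤ n * 2 ^ k
        2^[t+k]≤ = begin
          2 ^ (t + pred k)     ≤⟨ ^-monoʳ-≤ 2 (+-monoʳ-≤ t (pred[n]≤n {k})) ⟩
          2 ^ (t + k)          ≡⟨ ^-distribˡ-+-* 2 t k ⟩
          2 ^ t * 2 ^ k        ≤⟨ *-monoˡ-≤ (2 ^ k) (2^⌊log₂n⌋≤n 0<n) ⟩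
          n * 2 ^ k            ∎

      -- Beside n² there remain 2^k twice and 4^k, together 16^k. Allowing these one more factor `n`
      -- gives the third power.
      leaves≤n³ : 16 ^ k ≤ n → u * k ^ k ≤ n ^ 3 * h ^ k
      leaves≤n³ 16^k≤n = cancel
        (*-mono-≤ 2^[t+k]≤ (≤-trans (multichoose≤2^ t (pred k)) 2^[t+k]≤)) (begin
        n * 2 ^ k * (n * 2 ^ k) * 4 ^ k    ≡⟨ lemma n (2 ^ k) (4 ^ k) ⟩
        n * n * (2 ^ k * (2 ^ k * 4 ^ k))  ≡⟨ cong (λ x → n * n * (2 ^ k * x)) (^-distribʳ-* 2 4 k) ⟨
        n * n * (2 ^ k * 8 ^ k)            ≡⟨ cong (n * n *_) (^-distribʳ-* 2 8 k) ⟨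
        n * n * 16 ^ k                     ≤⟨ *-monoʳ-≤ (n * n) 16^k≤n ⟩
        n * n * n                          ≡⟨ n³ n ⟩
        n ^ 3                              ∎)
        where
        lemma : ∀ n x y → n * x * (n * x) * y ≡ n * n * (x * (x * y))
        lemma = solve-∀
        n³ : ∀ n → n * n * n ≡ n * (n * (n * 1))
        n³ = solve-∀

      -- The binomial coefficient is bounded by (t+1)^k instead of 2^(t+k), which would cost a
      -- second factor `n`.
      leaves≤n*polylog : u * k ^ k ≤ n * (8 * suc t) ^ k * h ^ k
      leaves≤n*polylog = cancel
        (*-mono-≤ 2^[t+k]≤ (≤-trans (multichoose≤^ t (pred k)) (^-monoʳ-≤ (suc t) (pred[n]≤n {k})))) (begin
        n * 2 ^ k * suc t ^ k * 4 ^ k      ≡⟨ lemma n (2 ^ k) (suc t ^ k) (4 ^ k) ⟩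
        n * (2 ^ k * 4 ^ k * suc t ^ k)    ≡⟨ cong (λ x → n * (x * suc t ^ k)) (^-distribʳ-* 2 4 k) ⟨
        n * (8 ^ k * suc t ^ k)            ≡⟨ cong (n *_) (^-distribʳ-* 8 (suc t) k) ⟨
        n * (8 * suc t) ^ k                ∎)
        where
        lemma : ∀ n x y z → n * x * y * z ≡ n * (x * z * y)
        lemma = solve-∀

open LeafBounds 273 100 k^k≤2·73^k*k!

-- The exponent is 109/20 = 4 + 29/20, and 29/20 = 1.45. The computed check is 273^20 ≤ 2^29 ·
-- 100^20.
leaves≤n^5·45 : ∀ n h k .{{_ : NonZero k}} → 0 < n → k ≤ h → k ≤ ⌊log₂ n ⌋ →
  (leaves (U k ⌊log₂ n ⌋ h) * k ^ k) ^ 20 ≤ n ^ 109 * (h ^ k) ^ 20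
leaves≤n^5·45 n h k 0<n k≤h = leaves≤n^[4+b/a] n h k 0<n k≤h 20 29 (≤ᵇ⇒≤ _ _ _)

-- Rational powers as inequalities between natural numbers

toℚᵘ-/ : ∀ i d .{{_ : NonZero d}} → toℚᵘ (i / d) ℚᵘ.≃ i ℚᵘ./ d
toℚᵘ-/ i (suc d) = ℚ.toℚᵘ-fromℚᵘ (mkℚᵘ i d)

fromℕ-* : ∀ m n → fromℕ (m * n) ≡ fromℕ m ℚ.* fromℕ n
fromℕ-* m n = ℚ.toℚᵘ-injective (begin
  toℚᵘ (fromℕ (m * n))                        ≈⟨ toℚᵘ-/ (+ (m * n)) 1 ⟩
  mkℚᵘ (+ (m * n)) 0                          ≈⟨ *≡* (cong (ℤ._* + 1) (ℤ.pos-* m n)) ⟩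
  mkℚᵘ (+ m) 0 ℚᵘ.* mkℚᵘ (+ n) 0              ≈⟨ ℚᵘ.*-cong (toℚᵘ-/ (+ m) 1) (toℚᵘ-/ (+ n) 1) ⟨
  toℚᵘ (fromℕ m) ℚᵘ.* toℚᵘ (fromℕ n)          ≈⟨ ℚ.toℚᵘ-homo-* (fromℕ m) (fromℕ n) ⟨
  toℚᵘ (fromℕ m ℚ.* fromℕ n)                  ∎)
  where open ℚᵘ.≃-Reasoning

fromℕ-+ : ∀ m n → fromℕ (m + n) ≡ fromℕ m ℚ.+ fromℕ n
fromℕ-+ m n = ℚ.toℚᵘ-injective (begin
  toℚᵘ (fromℕ (m + n))                        ≈⟨ toℚᵘ-/ (+ (m + n)) 1 ⟩
  mkℚᵘ (+ (m + n)) 0                          ≈⟨ *≡* (cong (ℤ._* + 1) (cong₂ ℤ._+_ (sym (ℤ.*-identityʳ (+ m))) (sym (ℤ.*-identityʳ (+ n))))) ⟩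
  mkℚᵘ (+ m) 0 ℚᵘ.+ mkℚᵘ (+ n) 0              ≈⟨ ℚᵘ.+-cong (toℚᵘ-/ (+ m) 1) (toℚᵘ-/ (+ n) 1) ⟨
  toℚᵘ (fromℕ m) ℚᵘ.+ toℚᵘ (fromℕ n)          ≈⟨ ℚ.toℚᵘ-homo-+ (fromℕ m) (fromℕ n) ⟨
  toℚᵘ (fromℕ m ℚ.+ fromℕ n)                  ∎)
  where open ℚᵘ.≃-Reasoning

fromℕ-^ : ∀ m n → fromℕ (m ^ n) ≡ fromℕ m ^ℚ n
fromℕ-^ m zero    = refl
fromℕ-^ m (suc n) = trans (fromℕ-* m (m ^ n)) (cong (fromℕ m ℚ.*_) (fromℕ-^ m n))

fromℕ-mono : ∀ {m n} → m ≤ n → fromℕ m ℚ.≤ fromℕ n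
fromℕ-mono {m} {n} m≤n = ℚ.toℚᵘ-cancel-≤ (begin
  toℚᵘ (fromℕ m)  ≃⟨ toℚᵘ-/ (+ m) 1 ⟩
  mkℚᵘ (+ m) 0    ≤⟨ *≤* (ℤ.*-monoʳ-≤-nonNeg (+ 1) (ℤ.+≤+ m≤n)) ⟩
  mkℚᵘ (+ n) 0    ≃⟨ toℚᵘ-/ (+ n) 1 ⟨
  toℚᵘ (fromℕ n)  ∎)
  where open ℚᵘ.≤-Reasoning

fromℕ-cancel : ∀ {m n} → fromℕ m ℚ.≤ fromℕ n → m ≤ n
fromℕ-cancel {m} {n} p = ℤ.drop‿+≤+ (ℤ.*-cancelʳ-≤-pos (+ m) (+ n) (+ 1) (ℚᵘ.drop-*≤* (begin
  mkℚᵘ (+ m) 0    ≃⟨ toℚᵘ-/ (+ m) 1 ⟨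
  toℚᵘ (fromℕ m)  ≤⟨ ℚ.toℚᵘ-mono-≤ p ⟩
  toℚᵘ (fromℕ n)  ≃⟨ toℚᵘ-/ (+ n) 1 ⟩
  mkℚᵘ (+ n) 0    ∎)))
  where open ℚᵘ.≤-Reasoning

fromℕ-pos : ∀ n .{{_ : NonZero n}} → ℚ.Positive (fromℕ n)
fromℕ-pos n = ℚ.normalize-pos n 1

/-*-cancel : ∀ i d .{{_ : NonZero d}} → (i / d) ℚ.* fromℕ d ≡ i / 1
/-*-cancel i d@(suc d-1) = ℚ.toℚᵘ-injective (begin
  toℚᵘ ((i / d) ℚ.* fromℕ d)           ≈⟨ ℚ.toℚᵘ-homo-* (i / d) (fromℕ d) ⟩
  toℚᵘ (i / d) ℚᵘ.* toℚᵘ (fromℕ d)     ≈⟨ ℚᵘ.*-cong (toℚᵘ-/ i d) (toℚᵘ-/ (+ d) 1) ⟩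
  mkℚᵘ i d-1 ℚᵘ.* mkℚᵘ (+ d) 0         ≈⟨ *≡* (trans (ℤ.*-identityʳ (i ℤ.* + d)) (cong (λ e → i ℤ.* + e) (sym (*-identityʳ d)))) ⟩
  mkℚᵘ i 0                             ≈⟨ toℚᵘ-/ i 1 ⟨
  toℚᵘ (i / 1)                         ∎)
  where open ℚᵘ.≃-Reasoning

*-↧ : ∀ r → r ℚ.* fromℕ (↧ₙ r) ≡ ↥ r / 1
*-↧ r = trans (cong (ℚ._* fromℕ (↧ₙ r)) (sym (ℚ.↥p/↧p≡p r))) (/-*-cancel (↥ r) (↧ₙ r))

-- r = (a − b) / q
record IsQuotient (r : ℚ) (a b q : ℕ) : Set where
  constructor quotient
  field equation : r ℚ.* fromℕ q ℚ.+ fromℕ b ≡ fromℕ a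

-- x = X / D
record IsFraction (x : ℚ) (X D : ℕ) : Set where
  constructor fraction
  field equation : x ℚ.* fromℕ D ≡ fromℕ X

numerator⁺ numerator⁻ : ℚ → ℕ
numerator⁺ (mkℚ (+ p)    _ _) = p
numerator⁺ (mkℚ -[1+ p ] _ _) = 0
numerator⁻ (mkℚ (+ p)    _ _) = 0
numerator⁻ (mkℚ -[1+ p ] _ _) = suc p

isQuotient : ∀ r → IsQuotient r (numerator⁺ r) (numerator⁻ r) (↧ₙ r)
isQuotient r@(mkℚ (+ p)    _ _) = quotient (trans (ℚ.+-identityʳ _) (*-↧ r))
isQuotient r@(mkℚ -[1+ p ] _ _) =
  quotient (trans (cong (ℚ._+ fromℕ (suc p)) (*-↧ r)) (ℚ.+-inverseˡ (fromℕ (suc p))))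

isQuotient-/ : ∀ m d .{{_ : NonZero d}} → IsQuotient (+ m / d) m 0 d
isQuotient-/ m d = quotient (trans (ℚ.+-identityʳ _) (/-*-cancel (+ m) d))

isQuotient-+ : ∀ {r s a b q a′ b′ q′} → IsQuotient r a b q → IsQuotient s a′ b′ q′ →
  IsQuotient (r ℚ.+ s) (a * q′ + a′ * q) (b * q′ + b′ * q) (q * q′)
isQuotient-+ {r} {s} {a} {b} {q} {a′} {b′} {q′} (quotient eq) (quotient eq′) = quotient (begin
  (r ℚ.+ s) ℚ.* fromℕ (q * q′) ℚ.+ fromℕ (b * q′ + b′ * q)
    ≡⟨ cong₂ (λ x y → (r ℚ.+ s) ℚ.* x ℚ.+ y) (fromℕ-* q q′) (expand b b′) ⟩
  (r ℚ.+ s) ℚ.* (Q ℚ.* Q′) ℚ.+ (fromℕ b ℚ.* Q′ ℚ.+ fromℕ b′ ℚ.* Q)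
    ≡⟨ solve 6 (λ r s Q Q′ B B′ → (r :+ s) :* (Q :* Q′) :+ (B :* Q′ :+ B′ :* Q) :=
         (r :* Q :+ B) :* Q′ :+ (s :* Q′ :+ B′) :* Q) refl r s Q Q′ (fromℕ b) (fromℕ b′) ⟩
  (r ℚ.* Q ℚ.+ fromℕ b) ℚ.* Q′ ℚ.+ (s ℚ.* Q′ ℚ.+ fromℕ b′) ℚ.* Q
    ≡⟨ cong₂ (λ x y → x ℚ.* Q′ ℚ.+ y ℚ.* Q) eq eq′ ⟩
  fromℕ a ℚ.* Q′ ℚ.+ fromℕ a′ ℚ.* Q
    ≡⟨ expand a a′ ⟨
  fromℕ (a * q′ + a′ * q) ∎)
  where
  open ≡-Reasoning
  open +-*-Solver
  Q  = fromℕ q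
  Q′ = fromℕ q′
  expand : ∀ m m′ → fromℕ (m * q′ + m′ * q) ≡ fromℕ m ℚ.* Q′ ℚ.+ fromℕ m′ ℚ.* Q
  expand m m′ = trans (fromℕ-+ (m * q′) (m′ * q)) (cong₂ ℚ._+_ (fromℕ-* m q′) (fromℕ-* m′ q))

isQuotient-≤ : ∀ {r s a b q a′ b′ q′} → r ℚ.≤ s → IsQuotient r a b q → IsQuotient s a′ b′ q′ →
  a * q′ + b′ * q ≤ a′ * q + b * q′
isQuotient-≤ {r} {s} {a} {b} {q} {a′} {b′} {q′} r≤s (quotient eq) (quotient eq′) = fromℕ-cancel (begin
  fromℕ (a * q′ + b′ * q)
    ≡⟨ expand a q′ b′ q ⟩
  fromℕ a ℚ.* Q′ ℚ.+ fromℕ b′ ℚ.* Q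
    ≡⟨ cong (λ x → x ℚ.* Q′ ℚ.+ fromℕ b′ ℚ.* Q) eq ⟨
  (r ℚ.* Q ℚ.+ fromℕ b) ℚ.* Q′ ℚ.+ fromℕ b′ ℚ.* Q
    ≡⟨ solve 5 (λ r Q Q′ B B′ → (r :* Q :+ B) :* Q′ :+ B′ :* Q :=
         r :* (Q :* Q′) :+ (B′ :* Q :+ B :* Q′)) refl r Q Q′ (fromℕ b) (fromℕ b′) ⟩
  r ℚ.* (Q ℚ.* Q′) ℚ.+ (fromℕ b′ ℚ.* Q ℚ.+ fromℕ b ℚ.* Q′)
    ≤⟨ ℚ.+-monoˡ-≤ _ (ℚ.*-monoʳ-≤-nonNeg (Q ℚ.* Q′) {{QQ′≥0}} r≤s) ⟩
  s ℚ.* (Q ℚ.* Q′) ℚ.+ (fromℕ b′ ℚ.* Q ℚ.+ fromℕ b ℚ.* Q′)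
    ≡⟨ solve 5 (λ s Q Q′ B B′ → s :* (Q :* Q′) :+ (B′ :* Q :+ B :* Q′) :=
         (s :* Q′ :+ B′) :* Q :+ B :* Q′) refl s Q Q′ (fromℕ b) (fromℕ b′) ⟩
  (s ℚ.* Q′ ℚ.+ fromℕ b′) ℚ.* Q ℚ.+ fromℕ b ℚ.* Q′
    ≡⟨ cong (λ x → x ℚ.* Q ℚ.+ fromℕ b ℚ.* Q′) eq′ ⟩
  fromℕ a′ ℚ.* Q ℚ.+ fromℕ b ℚ.* Q′
    ≡⟨ expand a′ q b q′ ⟨
  fromℕ (a′ * q + b * q′) ∎)
  where
  open ℚ.≤-Reasoning
  open +-*-Solver
  Q  = fromℕ q
  Q′ = fromℕ q′
  QQ′≥0 : ℚ.NonNegative (Q ℚ.* Q′)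
  QQ′≥0 = subst ℚ.NonNegative (fromℕ-* q q′) (ℚ.normalize-nonNeg (q * q′) 1)
  expand : ∀ m n m′ n′ → fromℕ (m * n + m′ * n′) ≡ fromℕ m ℚ.* fromℕ n ℚ.+ fromℕ m′ ℚ.* fromℕ n′
  expand m n m′ n′ = trans (fromℕ-+ (m * n) (m′ * n′)) (cong₂ ℚ._+_ (fromℕ-* m n) (fromℕ-* m′ n′))

isFraction-* : ∀ {x y X Y D E} → IsFraction x X D → IsFraction y Y E →
  IsFraction (x ℚ.* y) (X * Y) (D * E)
isFraction-* {x} {y} {X} {Y} {D} {E} (fraction x≡) (fraction y≡) = fraction (begin
  x ℚ.* y ℚ.* fromℕ (D * E)               ≡⟨ cong (x ℚ.* y ℚ.*_) (fromℕ-* D E) ⟩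
  x ℚ.* y ℚ.* (fromℕ D ℚ.* fromℕ E)
    ≡⟨ solve 4 (λ x y D E → x :* y :* (D :* E) := x :* D :* (y :* E)) refl x y (fromℕ D) (fromℕ E) ⟩
  x ℚ.* fromℕ D ℚ.* (y ℚ.* fromℕ E)       ≡⟨ cong₂ ℚ._*_ x≡ y≡ ⟩
  fromℕ X ℚ.* fromℕ Y                     ≡⟨ fromℕ-* X Y ⟨
  fromℕ (X * Y)                           ∎)
  where
  open ≡-Reasoning
  open +-*-Solver

isFraction-fromℕ : ∀ m D → IsFraction (fromℕ m) (m * D) D
isFraction-fromℕ m D = fraction (sym (fromℕ-* m D))

isFraction-fromℕ/1 : ∀ m → IsFraction (fromℕ m) m 1
isFraction-fromℕ/1 m = fraction (ℚ.*-identityʳ (fromℕ m))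

isFraction-1 : ∀ D → IsFraction 1ℚ D D
isFraction-1 D = fraction (ℚ.*-identityˡ (fromℕ D))

isFraction-^ : ∀ {x X D} → IsFraction x X D → ∀ q → IsFraction (x ^ℚ q) (X ^ q) (D ^ q)
isFraction-^ x≡ zero    = fraction refl
isFraction-^ x≡ (suc q) = isFraction-* x≡ (isFraction-^ x≡ q)

isFraction-≤ : ∀ {x y X Y D} .{{_ : NonZero D}} → IsFraction x X D → IsFraction y Y D →
  x ℚ.≤ y ⇔ X ≤ Y
isFraction-≤ {x} {y} {X} {Y} {D} (fraction x≡) (fraction y≡) = mk⇔
  (λ x≤y → fromℕ-cancel (subst₂ ℚ._≤_ x≡ y≡ (ℚ.*-monoʳ-≤-nonNeg (fromℕ D) x≤y)))
  (λ X≤Y → ℚ.*-cancelʳ-≤-pos (fromℕ D) (subst₂ ℚ._≤_ (sym x≡) (sym y≡) (fromℕ-mono X≤Y)))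
  where
  instance
    _ = fromℕ-pos D
    _ = ℚ.pos⇒nonNeg (fromℕ D)

-- X ≤ n^((a − b) / q) · Y, for q ≥ 1
record _≤[_^⟨_-_⟩/_]*_ (X n a b q Y : ℕ) : Set where
  constructor cleared
  field inequality : X ^ q * n ^ b ≤ n ^ a * Y ^ q

^-cancelʳ-≤ : ∀ {m n} q .{{_ : NonZero q}} → m ^ q ≤ n ^ q → m ≤ n
^-cancelʳ-≤ q p = ≮⇒≥ λ n<m → <⇒≱ (^-monoˡ-< q n<m) p

-- The hypothesis on exponents says (a - b)/q ≤ (a′ - b′)/q′. Raise to the power `q′`, enlarge the
-- exponent of `n`, cancel `n ^ (b * q′)` and take a `q`-th root. This covers both a larger exponent
-- and another quotient for the same one.
≤[^]*-weaken : ∀ {X n a b q Y a′ b′ q′} .{{_ : NonZero q}} .{{_ : NonZero n}} →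
  a * q′ + b′ * q ≤ a′ * q + b * q′ →
  X ≤[ n ^⟨ a - b ⟩/ q ]* Y → X ≤[ n ^⟨ a′ - b′ ⟩/ q′ ]* Y
≤[^]*-weaken {X} {n} {a} {b} {q} {Y} {a′} {b′} {q′} eq (cleared X≤) = cleared (^-cancelʳ-≤ q
  (*-cancelʳ-≤ _ _ (n ^ (b * q′)) {{m^n≢0 n (b * q′)}} (begin
  (X ^ q′ * n ^ b′) ^ q * n ^ (b * q′)
    ≡⟨ cong (_* n ^ (b * q′)) (^-distribʳ-* (X ^ q′) (n ^ b′) q) ⟩
  (X ^ q′) ^ q * (n ^ b′) ^ q * n ^ (b * q′)
    ≡⟨ cong₂ (λ x y → x * y * n ^ (b * q′)) (^-comm X q′ q) (^-*-assoc n b′ q) ⟩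
  (X ^ q) ^ q′ * n ^ (b′ * q) * n ^ (b * q′)
    ≡⟨ lemma₁ ((X ^ q) ^ q′) _ _ ⟩
  (X ^ q) ^ q′ * n ^ (b * q′) * n ^ (b′ * q)
    ≡⟨ cong (λ y → (X ^ q) ^ q′ * y * n ^ (b′ * q)) (^-*-assoc n b q′) ⟨
  (X ^ q) ^ q′ * (n ^ b) ^ q′ * n ^ (b′ * q)
    ≡⟨ cong (_* n ^ (b′ * q)) (^-distribʳ-* (X ^ q) (n ^ b) q′) ⟨
  (X ^ q * n ^ b) ^ q′ * n ^ (b′ * q)
    ≤⟨ *-monoˡ-≤ (n ^ (b′ * q)) (^-monoˡ-≤ q′ X≤) ⟩
  (n ^ a * Y ^ q) ^ q′ * n ^ (b′ * q)
    ≡⟨ cong (_* n ^ (b′ * q)) (^-distribʳ-* (n ^ a) (Y ^ q) q′) ⟩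
  (n ^ a) ^ q′ * (Y ^ q) ^ q′ * n ^ (b′ * q)
    ≡⟨ cong₂ (λ x y → x * y * n ^ (b′ * q)) (^-*-assoc n a q′) (^-comm Y q q′) ⟩
  n ^ (a * q′) * (Y ^ q′) ^ q * n ^ (b′ * q)
    ≡⟨ collect (a * q′) (b′ * q) ⟩
  n ^ (a * q′ + b′ * q) * (Y ^ q′) ^ q
    ≤⟨ *-monoˡ-≤ ((Y ^ q′) ^ q) (^-monoʳ-≤ n eq) ⟩
  n ^ (a′ * q + b * q′) * (Y ^ q′) ^ q
    ≡⟨ collect (a′ * q) (b * q′) ⟨
  n ^ (a′ * q) * (Y ^ q′) ^ q * n ^ (b * q′)
    ≡⟨ cong (λ x → x * (Y ^ q′) ^ q * n ^ (b * q′)) (^-*-assoc n a′ q) ⟨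
  (n ^ a′) ^ q * (Y ^ q′) ^ q * n ^ (b * q′)
    ≡⟨ cong (_* n ^ (b * q′)) (^-distribʳ-* (n ^ a′) (Y ^ q′) q) ⟨
  (n ^ a′ * Y ^ q′) ^ q * n ^ (b * q′) ∎)))
  where
  open ≤-Reasoning
  lemma₁ : ∀ a b c → a * b * c ≡ a * c * b
  lemma₁ = solve-∀
  collect : ∀ i j → n ^ i * (Y ^ q′) ^ q * n ^ j ≡ n ^ (i + j) * (Y ^ q′) ^ q
  collect i j = trans (lemma₁ (n ^ i) _ _) (cong (_* (Y ^ q′) ^ q) (sym (^-distribˡ-+-* n i j)))

module _ {x y : ℚ} {X Y D : ℕ} .{{_ : NonZero D}} (x≡ : IsFraction x X D) (y≡ : IsFraction y Y D) where

  private
    scaled : ∀ n a q → IsFraction (fromℕ n ^ℚ a ℚ.* y ^ℚ q) (n ^ a * Y ^ q) (D ^ q)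
    scaled n a q = subst₂ (λ z E → IsFraction (z ℚ.* y ^ℚ q) (n ^ a * Y ^ q) E)
      (fromℕ-^ n a) (*-identityˡ (D ^ q))
      (isFraction-* (isFraction-fromℕ/1 (n ^ a)) (isFraction-^ y≡ q))

    scaledʳ : ∀ n a q → IsFraction (x ^ℚ q ℚ.* fromℕ n ^ℚ a) (X ^ q * n ^ a) (D ^ q)
    scaledʳ n a q = subst₂ (λ z E → IsFraction (x ^ℚ q ℚ.* z) (X ^ q * n ^ a) E)
      (fromℕ-^ n a) (*-identityʳ (D ^ q))
      (isFraction-* (isFraction-^ x≡ q) (isFraction-fromℕ/1 (n ^ a)))

    canonical : ∀ r n → x ≤[ n ^ r ]* y ⇔ X ≤[ n ^⟨ numerator⁺ r - numerator⁻ r ⟩/ ↧ₙ r ]* Y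
    canonical r@(mkℚ (+ p) d-1 _) n = mk⇔
      (λ p → cleared (≤-trans (≤-reflexive (*-identityʳ (X ^ ↧ₙ r))) (to eqv p)))
      (λ (cleared p) → from eqv (≤-trans (≤-reflexive (sym (*-identityʳ (X ^ ↧ₙ r)))) p))
      where
      eqv = isFraction-≤ {{m^n≢0 D (↧ₙ r)}} (isFraction-^ x≡ (↧ₙ r)) (scaled n p (↧ₙ r))
    canonical r@(mkℚ -[1+ p ] d-1 _) n = mk⇔
      (λ p → cleared (≤-trans (to eqv p) (≤-reflexive (sym (*-identityˡ (Y ^ ↧ₙ r))))))
      (λ (cleared p) → from eqv (≤-trans p (≤-reflexive (*-identityˡ (Y ^ ↧ₙ r)))))
      where
      eqv = isFraction-≤ {{m^n≢0 D (↧ₙ r)}} (scaledʳ n (suc p) (↧ₙ r)) (isFraction-^ y≡ (↧ₙ r))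

  -- `_≤[_^_]*_` inspects the lowest terms of the exponent and does not reduce on a computed one
  -- such as a sum; here any quotient may represent `r`.
  ≤[^]*⇔ : ∀ {r n a b q} .{{_ : NonZero n}} .{{_ : NonZero q}} → IsQuotient r a b q →
    x ≤[ n ^ r ]* y ⇔ X ≤[ n ^⟨ a - b ⟩/ q ]* Y
  ≤[^]*⇔ {r} {n} r≡ = mk⇔
    (≤[^]*-weaken (isQuotient-≤ ℚ.≤-refl (isQuotient r) r≡) ∘ to (canonical r n))
    (from (canonical r n) ∘ ≤[^]*-weaken (isQuotient-≤ ℚ.≤-refl r≡ (isQuotient r)))

  ≤[^]*-intro : ∀ {r s n a b q} .{{_ : NonZero n}} .{{_ : NonZero q}} → IsQuotient r a b q → r ℚ.≤ s →
    X ≤[ n ^⟨ a - b ⟩/ q ]* Y → x ≤[ n ^ s ]* y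
  ≤[^]*-intro {s = s} {n} r≡ r≤s = from (canonical s n) ∘ ≤[^]*-weaken (isQuotient-≤ r≤s r≡ (isQuotient s))

isFraction-scaleʳ : ∀ {x X D} → IsFraction x X D → ∀ E → IsFraction x (X * E) (D * E)
isFraction-scaleʳ x≡ E =
  subst (λ z → IsFraction z _ _) (ℚ.*-identityʳ _) (isFraction-* x≡ (isFraction-1 E))

isFraction-scaleˡ : ∀ {x X D} E → IsFraction x X D → IsFraction x (E * X) (E * D)
isFraction-scaleˡ E x≡ =
  subst (λ z → IsFraction z _ _) (ℚ.*-identityˡ _) (isFraction-* (isFraction-1 E) x≡)

isFraction-0 : ∀ D → IsFraction 0ℚ 0 D
isFraction-0 D = fraction (ℚ.*-zeroˡ (fromℕ D))

isFraction-nonNeg : ∀ {x} → 0ℚ ℚ.≤ x → IsFraction x (numerator⁺ x) (↧ₙ x)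
isFraction-nonNeg {x@(mkℚ (+ _) _ _)}    _   = fraction (*-↧ x)
isFraction-nonNeg {mkℚ -[1+ _ ] _ _} 0≤x = contradiction 0≤x λ { (ℚ.*≤* ()) }

isFraction-pos : ∀ {x} → 0ℚ ℚ.< x → 0 < numerator⁺ x
isFraction-pos {x} 0<x = ≰⇒> λ p →
  ℚ.<-irrefl refl (ℚ.<-≤-trans 0<x
    (from (isFraction-≤ (isFraction-nonNeg (ℚ.<⇒≤ 0<x)) (isFraction-0 (↧ₙ x))) p))

isQuotient-resp : ∀ {r s a b q} → r ≡ s → IsQuotient r a b q → IsQuotient s a b q
isQuotient-resp refl r≡ = r≡

isQuotient-difference : ∀ p m q .{{_ : NonZero q}} → IsQuotient (+ p / q ℚ.- + m / q) p m q
isQuotient-difference p m q = quotient (begin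
  (+ p / q ℚ.- + m / q) ℚ.* fromℕ q ℚ.+ fromℕ m
    ≡⟨ cong ((+ p / q ℚ.- + m / q) ℚ.* fromℕ q ℚ.+_) (/-*-cancel (+ m) q) ⟨
  (+ p / q ℚ.- + m / q) ℚ.* fromℕ q ℚ.+ + m / q ℚ.* fromℕ q
    ≡⟨ solve 3 (λ a b c → (a :- b) :* c :+ b :* c := a :* c) refl (+ p / q) (+ m / q) (fromℕ q) ⟩
  + p / q ℚ.* fromℕ q
    ≡⟨ /-*-cancel (+ p) q ⟩
  fromℕ p ∎)
  where
  open ≡-Reasoning
  open +-*-Solver

-- For the choice r = (p - bq)/(dq) and C = (a - b)/d, the terms in b cancel in r - C, so its
-- numerator is again a difference of the naturals at hand.
isQuotient-minus : ∀ {r s a b d p q} → IsQuotient r p (b * q) (d * q) → IsQuotient s a b d →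
  IsQuotient (r ℚ.- s) p (a * q) (d * q)
isQuotient-minus {r} {s} {a} {b} {d} {p} {q} (quotient eq) (quotient eq′) = quotient (begin
  (r ℚ.- s) ℚ.* fromℕ (d * q) ℚ.+ fromℕ (a * q)
    ≡⟨ cong₂ (λ x y → (r ℚ.- s) ℚ.* x ℚ.+ y) (fromℕ-* d q) (trans (fromℕ-* a q) (cong (ℚ._* Q) (sym eq′))) ⟩
  (r ℚ.- s) ℚ.* (D ℚ.* Q) ℚ.+ (s ℚ.* D ℚ.+ B) ℚ.* Q
    ≡⟨ solve 5 (λ r s D B Q → (r :- s) :* (D :* Q) :+ (s :* D :+ B) :* Q := r :* (D :* Q) :+ B :* Q)
         refl r s D B Q ⟩
  r ℚ.* (D ℚ.* Q) ℚ.+ B ℚ.* Q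
    ≡⟨ cong₂ (λ x y → r ℚ.* x ℚ.+ y) (fromℕ-* d q) (fromℕ-* b q) ⟨
  r ℚ.* fromℕ (d * q) ℚ.+ fromℕ (b * q)
    ≡⟨ eq ⟩
  fromℕ p ∎)
  where
  open ≡-Reasoning
  open +-*-Solver
  D = fromℕ d
  Q = fromℕ q
  B = fromℕ b

-- Exponents add, and the resulting indices are those that `isQuotient-+` produces.
≤[^]*-trans : ∀ {X Y Z n a b q a′ b′ q′} →
  X ≤[ n ^⟨ a - b ⟩/ q ]* Y → Y ≤[ n ^⟨ a′ - b′ ⟩/ q′ ]* Z →
  X ≤[ n ^⟨ a * q′ + a′ * q - b * q′ + b′ * q ⟩/ q * q′ ]* Z
≤[^]*-trans {X} {Y} {Z} {n} {a} {b} {q} {a′} {b′} {q′} (cleared p) (cleared p′) = cleared (begin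
  X ^ (q * q′) * n ^ (b * q′ + b′ * q)
    ≡⟨ cong (X ^ (q * q′) *_) (^-distribˡ-+-* n (b * q′) (b′ * q)) ⟩
  X ^ (q * q′) * (n ^ (b * q′) * n ^ (b′ * q))
    ≡⟨ *-assoc (X ^ (q * q′)) _ _ ⟨
  X ^ (q * q′) * n ^ (b * q′) * n ^ (b′ * q)
    ≡⟨ cong (_* n ^ (b′ * q)) (power X n b q q′) ⟨
  (X ^ q * n ^ b) ^ q′ * n ^ (b′ * q)
    ≤⟨ *-monoˡ-≤ (n ^ (b′ * q)) (^-monoˡ-≤ q′ p) ⟩
  (n ^ a * Y ^ q) ^ q′ * n ^ (b′ * q)
    ≡⟨ cong (λ z → z ^ q′ * n ^ (b′ * q)) (*-comm (n ^ a) (Y ^ q)) ⟩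
  (Y ^ q * n ^ a) ^ q′ * n ^ (b′ * q)
    ≡⟨ cong (_* n ^ (b′ * q)) (power Y n a q q′) ⟩
  Y ^ (q * q′) * n ^ (a * q′) * n ^ (b′ * q)
    ≡⟨ lemma (Y ^ (q * q′)) _ _ ⟩
  n ^ (a * q′) * (Y ^ (q * q′) * n ^ (b′ * q))
    ≡⟨ cong (λ e → n ^ (a * q′) * (Y ^ e * n ^ (b′ * q))) (*-comm q q′) ⟩
  n ^ (a * q′) * (Y ^ (q′ * q) * n ^ (b′ * q))
    ≡⟨ cong (n ^ (a * q′) *_) (power Y n b′ q′ q) ⟨
  n ^ (a * q′) * (Y ^ q′ * n ^ b′) ^ q
    ≤⟨ *-monoʳ-≤ (n ^ (a * q′)) (^-monoˡ-≤ q p′) ⟩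
  n ^ (a * q′) * (n ^ a′ * Z ^ q′) ^ q
    ≡⟨ cong (λ z → n ^ (a * q′) * z ^ q) (*-comm (n ^ a′) (Z ^ q′)) ⟩
  n ^ (a * q′) * (Z ^ q′ * n ^ a′) ^ q
    ≡⟨ cong (n ^ (a * q′) *_) (power Z n a′ q′ q) ⟩
  n ^ (a * q′) * (Z ^ (q′ * q) * n ^ (a′ * q))
    ≡⟨ cong (λ e → n ^ (a * q′) * (Z ^ e * n ^ (a′ * q))) (*-comm q′ q) ⟩
  n ^ (a * q′) * (Z ^ (q * q′) * n ^ (a′ * q))
    ≡⟨ lemma′ (n ^ (a * q′)) _ _ ⟩
  n ^ (a * q′) * n ^ (a′ * q) * Z ^ (q * q′)
    ≡⟨ cong (_* Z ^ (q * q′)) (^-distribˡ-+-* n (a * q′) (a′ * q)) ⟨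
  n ^ (a * q′ + a′ * q) * Z ^ (q * q′) ∎)
  where
  open ≤-Reasoning
  power : ∀ X n b q q′ → (X ^ q * n ^ b) ^ q′ ≡ X ^ (q * q′) * n ^ (b * q′)
  power X n b q q′ = trans (^-distribʳ-* (X ^ q) (n ^ b) q′) (cong₂ _*_ (^-*-assoc X q q′) (^-*-assoc n b q′))
  lemma : ∀ a b c → a * b * c ≡ b * (a * c)
  lemma = solve-∀
  lemma′ : ∀ a b c → a * (b * c) ≡ a * c * b
  lemma′ = solve-∀

-- Rational powers between two numbers, and real exponents

n≤2^n : ∀ n → n ≤ 2 ^ n
n≤2^n zero    = z≤n
n≤2^n (suc n) = ≤-trans (+-mono-≤ (m^n>0 2 n) (n≤2^n n)) (+-monoʳ-≤ (2 ^ n) (m≤m+n _ _))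

-- The least power of `n` reaching a/e overshoots by a factor below `n`. The search descends from
-- the exponent `a`, where a ≤ 2^a ≤ n^a, and `e ≤ a` handles its end at 0.
power-between : ∀ {n e a} → 2 ≤ n → 0 < e → e ≤ a → ∃[ p ] (a ≤ n ^ p * e × n ^ p * e < n * a)
power-between {n} {e} {a} 2≤n 0<e e≤a = search a (begin
  a           ≤⟨ n≤2^n a ⟩
  2 ^ a       ≤⟨ ^-monoˡ-≤ a 2≤n ⟩
  n ^ a       ≤⟨ m≤m*n (n ^ a) e {{>-nonZero 0<e}} ⟩
  n ^ a * e   ∎)
  where
  open ≤-Reasoning
  search : ∀ m → a ≤ n ^ m * e → ∃[ p ] (a ≤ n ^ p * e × n ^ p * e < n * a)
  search zero    a≤ = 0 , a≤ , (begin-strict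
    1 * e  ≡⟨ *-identityˡ e ⟩
    e      ≤⟨ e≤a ⟩
    a      <⟨ m<m*n a n {{>-nonZero (≤-trans 0<e e≤a)}} 2≤n ⟩
    a * n  ≡⟨ *-comm a n ⟩
    n * a  ∎)
  search (suc m) a≤ with a ≤? n ^ m * e
  ... | yes p = search m p
  ... | no ¬p = suc m , a≤ , (begin-strict
    n * n ^ m * e    ≡⟨ *-assoc n (n ^ m) e ⟩
    n * (n ^ m * e)  <⟨ *-monoʳ-< n {{>-nonZero (≤-trans (s≤s z≤n) 2≤n)}} (≰⇒> ¬p) ⟩
    n * a            ∎)

-- This puts n^(p/q) · e between a and b. With q = na, `power-between` at the `q`-th powers gives
-- a^q ≤ n^p e^q < n a^q. Now n a^q = q a^(q-1) is one term of `bernoulli`, hence at most (a+1)^q ≤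
-- b^q.
separate : ∀ {n e a b} → 2 ≤ n → 0 < e → e ≤ a → a < b →
  ∃[ q ] NonZero q × ∃[ p ] (a ^ q ≤ n ^ p * e ^ q × n ^ p * e ^ q < b ^ q)
separate {a = zero} _ 0<e e≤0 _ = contradiction (≤-trans 0<e e≤0) λ ()
separate {n} {e} {a@(suc a-1)} {b} 2≤n@(s≤s _) 0<e e≤a a<b
  with p , a^q≤ , n^p< ← power-between 2≤n (m^n>0 e {{>-nonZero 0<e}} (n * a)) (^-monoˡ-≤ (n * a) e≤a) =
  n * a , _ , p , a^q≤ , (begin-strict
    n ^ p * e ^ (n * a)                      <⟨ n^p< ⟩
    n * (a * a ^ q-1)                        ≡⟨ *-assoc n a (a ^ q-1) ⟨
    n * a * a ^ q-1                          ≤⟨ m≤m+n _ _ ⟩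
    n * a * a ^ q-1 + a ^ (n * a)            ≤⟨ bernoulli a q-1 ⟩
    suc a ^ (n * a)                          ≤⟨ ^-monoˡ-≤ (n * a) a<b ⟩
    b ^ (n * a)                              ∎)
  where
  open ≤-Reasoning
  q-1 = pred (n * a)

module Exponents (n h k : ℕ) .{{_ : NonZero k}} (2≤n : 2 ≤ n) (k≤h : k ≤ h) where

  private
    instance
      n≢0 : NonZero n
      n≢0 = >-nonZero (≤-trans (s≤s z≤n) 2≤n)
      k^k≢0 : NonZero (k ^ k)
      k^k≢0 = m^n≢0 k k

  y≡ : IsFraction ((+ h / k) ^ℚ k) (h ^ k) (k ^ k)
  y≡ = isFraction-^ (fraction (/-*-cancel (+ h) k)) k

  module _ (C x : ℚ) (0≤x : 0ℚ ℚ.≤ x) where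

    private
      y = (+ h / k) ^ℚ k
      D = ↧ₙ x * k ^ k
      X = numerator⁺ x * k ^ k
      Y = ↧ₙ x * h ^ k
      a = numerator⁺ C
      b = numerator⁻ C
      d = ↧ₙ C
      instance
        D≢0 : NonZero D
        D≢0 = m*n≢0 (↧ₙ x) (k ^ k)
      x≡ : IsFraction x X D
      x≡ = isFraction-scaleʳ (isFraction-nonNeg 0≤x) (k ^ k)
      y≡′ : IsFraction y Y D
      y≡′ = isFraction-scaleˡ (↧ₙ x) y≡
      C≡ : IsQuotient C a b d
      C≡ = isQuotient C
      C+[r-C]≡r : ∀ r → C ℚ.+ (r ℚ.- C) ≡ r
      C+[r-C]≡r r = solve 2 (λ C r → C :+ (r :- C) := r) refl C r
        where open +-*-Solver

      -- As `k ≤ h`, the factor (h/k)^k is at least 1. This yields the lower bound `e ≤ a` required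
      -- by `separate`, whose exponent `p` is a natural number.
      D≤Y : D ≤ Y
      D≤Y = *-monoʳ-≤ (↧ₙ x) (^-monoˡ-≤ k k≤h)

      power : ∀ m i Z q → (m ^ i * Z ^ d) ^ q ≡ m ^ (i * q) * Z ^ (d * q)
      power m i Z q =
        trans (^-distribʳ-* (m ^ i) (Z ^ d) q) (cong₂ _*_ (^-*-assoc m i q) (^-*-assoc Z d q))

      -- A rational `r` above the real exponent satisfies y ≤ n^(r - C), so the two comparisons
      -- chain with total exponent C + (r - C) = r.
      n^[C+lg]⇒ : x ≤[ n ^ C ]* y → x ≤[ n ^ᴿ k ·lg (+ h / k) /lg n ⊕ C ]
      n^[C+lg]⇒ x≤ r y≤ = from
        (≤[^]*⇔ x≡ (isFraction-1 D) {{n≢0}} {{m*n≢0 d (↧ₙ (r ℚ.- C))}}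
          (isQuotient-resp (C+[r-C]≡r r) (isQuotient-+ C≡ (isQuotient (r ℚ.- C)))))
        (≤[^]*-trans (to (≤[^]*⇔ x≡ y≡′ C≡) x≤)
                     (to (≤[^]*⇔ y≡′ (isFraction-1 D) (isQuotient (r ℚ.- C))) y≤))

      -- If x > n^C y, a rational r with n^C y ≤ n^r < x refutes the hypothesis.
      n^[C+lg]⇐ : x ≤[ n ^ᴿ k ·lg (+ h / k) /lg n ⊕ C ] → x ≤[ n ^ C ]* y
      n^[C+lg]⇐ x≤ with X ^ d * n ^ b ≤? n ^ a * Y ^ d
      ... | yes p = from (≤[^]*⇔ x≡ y≡′ C≡) (cleared p)
      ... | no ¬p
        with q , q≢0 , p , n^C*y≤n^r , n^r<x ←
          separate 2≤n (m^n>0 D d) (≤-trans (^-monoˡ-≤ d D≤Y) (m≤n*m (Y ^ d) (n ^ a) {{m^n≢0 n a}})) (≰⇒> ¬p)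
        = let instance
                q≢0′ : NonZero q
                q≢0′ = q≢0
                dq≢0 : NonZero (d * q)
                dq≢0 = m*n≢0 d q
          in contradiction
            (_≤[_^⟨_-_⟩/_]*_.inequality
              (to (≤[^]*⇔ x≡ (isFraction-1 D) {{n≢0}} {{m*n≢0 d q}} (isQuotient-difference p (b * q) (d * q)))
                (x≤ (+ p / (d * q) ℚ.- + (b * q) / (d * q))
                  (from (≤[^]*⇔ y≡′ (isFraction-1 D) {{n≢0}} {{m*n≢0 d q}}
                          (isQuotient-minus {b = b} (isQuotient-difference p (b * q) (d * q)) C≡))
                    (cleared (begin
                      Y ^ (d * q) * n ^ (a * q)   ≡⟨ *-comm (Y ^ (d * q)) _ ⟩
                      n ^ (a * q) * Y ^ (d * q)   ≡⟨ power n a Y q ⟨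
                      (n ^ a * Y ^ d) ^ q         ≤⟨ n^C*y≤n^r ⟩
                      n ^ p * (D ^ d) ^ q         ≡⟨ cong (n ^ p *_) (^-*-assoc D d q) ⟩
                      n ^ p * D ^ (d * q)         ∎))))))
            (<⇒≱ (begin-strict
              n ^ p * D ^ (d * q)        ≡⟨ cong (n ^ p *_) (^-*-assoc D d q) ⟨
              n ^ p * (D ^ d) ^ q        <⟨ n^r<x ⟩
              (X ^ d * n ^ b) ^ q        ≡⟨ cong (_^ q) (*-comm (X ^ d) (n ^ b)) ⟩
              (n ^ b * X ^ d) ^ q        ≡⟨ power n b X q ⟩
              n ^ (b * q) * X ^ (d * q)  ≡⟨ *-comm (n ^ (b * q)) _ ⟩
              X ^ (d * q) * n ^ (b * q)  ∎))
        where open ≤-Reasoning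

    n^[C+lg]⇔ : x ≤[ n ^ C ]* y ⇔ x ≤[ n ^ᴿ k ·lg (+ h / k) /lg n ⊕ C ]
    n^[C+lg]⇔ = mk⇔ n^[C+lg]⇒ n^[C+lg]⇐

  module _ (L : ℕ) where

    leaves≤-intro : ∀ {c s a q} .{{_ : NonZero q}} → IsQuotient c a 0 q → c ℚ.≤ s →
      (L * k ^ k) ^ q ≤ n ^ a * (h ^ k) ^ q → fromℕ L ≤[ n ^ s ]* (+ h / k) ^ℚ k
    leaves≤-intro c≡ c≤s p = ≤[^]*-intro (isFraction-fromℕ L (k ^ k)) y≡ c≡ c≤s
      (cleared (≤-trans (≤-reflexive (*-identityʳ _)) p))

    -- Both exponents are rounded up to naturals: a/q to `e`, and `c` to `numerator⁺ c`, which is at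
    -- least `c` because the denominator is at least 1.
    polynomial : ∀ {c e a q} .{{_ : NonZero q}} → a ≤ e * q → (L * k ^ k) ^ q ≤ n ^ a * (h ^ k) ^ q →
      k ·lg (+ h / k) ≤ c ·lg n → L ≤ n ^ (e + numerator⁺ c)
    polynomial {c} {e} {a} {q} a≤ p y≤ = *-cancelʳ-≤ L _ (k ^ k) (begin
      L * k ^ k                          ≤⟨ inequality₁ (≤[^]*-weaken {a = a} {b = 0} {a′ = e} {b′ = 0} {q′ = 1} (≤-trans (≤-reflexive (lemma a)) (≤-trans a≤ (m≤m+n _ 0)))
                                              (cleared {L * k ^ k} {Y = h ^ k} (≤-trans (≤-reflexive (*-identityʳ _)) p))) ⟩
      n ^ e * h ^ k                      ≤⟨ *-monoʳ-≤ (n ^ e) (inequality₁ (≤[^]*-weaken {a′ = e′} {b′ = 0} {q′ = 1}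
                                              (≤-trans (≤-reflexive (lemma e′)) (≤-trans (m≤m*n e′ (↧ₙ c)) (m≤m+n _ _)))
                                              (to (≤[^]*⇔ y≡ (isFraction-1 (k ^ k)) (isQuotient c)) y≤))) ⟩
      n ^ e * (n ^ e′ * k ^ k)           ≡⟨ *-assoc (n ^ e) _ _ ⟨
      n ^ e * n ^ e′ * k ^ k             ≡⟨ cong (_* k ^ k) (^-distribˡ-+-* n e e′) ⟨
      n ^ (e + e′) * k ^ k               ∎)
      where
      open ≤-Reasoning
      e′ = numerator⁺ c
      lemma : ∀ a → a * 1 + 0 ≡ a
      lemma = solve-∀
      inequality₁ : ∀ {X a Y} → X ≤[ n ^⟨ a - 0 ⟩/ 1 ]* Y → X ≤ n ^ a * Y
      inequality₁ {X} {a} {Y} (cleared p) = subst₂ (λ x y → x ≤ n ^ a * y)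
        (trans (*-identityʳ (X * 1)) (*-identityʳ X)) (*-identityʳ Y) p

-- Asymptotics

e≤⌊log₂n⌋ : ∀ {e n} → 2 ^ e ≤ n → e ≤ ⌊log₂ n ⌋
e≤⌊log₂n⌋ {e} p = ≤-trans (≤-reflexive (sym (⌊log₂[2^n]⌋≡n e))) (⌊log₂⌋-mono-≤ p)

2*n≤2^n : ∀ n → 2 * n ≤ 2 ^ n
2*n≤2^n zero          = z≤n
2*n≤2^n (suc zero)    = ≤-refl
2*n≤2^n (suc n@(suc _)) = begin
  2 * suc n          ≡⟨ *-suc 2 n ⟩
  2 + 2 * n          ≤⟨ +-mono-≤ (^-monoʳ-≤ 2 {1} {n} (s≤s z≤n)) (2*n≤2^n n) ⟩
  2 ^ n + 2 ^ n      ≡⟨ cong (λ x → 2 ^ n + x) (+-identityʳ (2 ^ n)) ⟨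
  2 ^ suc n          ∎
  where open ≤-Reasoning

-- Split 2^l as 2^m · 2^(l-m). The first factor covers `m`; the second covers 4 + l, since
-- `2 * m + 4 ≤ l` means 4 + l ≤ 2(l - m).
linear≤2^ : ∀ m l → 2 * m + 4 ≤ l → m * (4 + l) ≤ 2 ^ l
linear≤2^ m l 2m+4≤l = begin
  m * (4 + l)      ≤⟨ *-mono-≤ (n≤2^n m) 4+l≤ ⟩
  2 ^ m * 2 ^ e    ≡⟨ ^-distribˡ-+-* 2 m e ⟨
  2 ^ (m + e)      ≡⟨ cong (2 ^_) m+e≡l ⟩
  2 ^ l            ∎
  where
  open ≤-Reasoning
  e = l ∸ m
  lemma : ∀ m → 2 * m + 4 ≡ m + (m + 4)
  lemma = solve-∀
  lemma′ : ∀ m e → 4 + (m + e) ≡ m + 4 + e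
  lemma′ = solve-∀
  m≤l : m ≤ l
  m≤l = ≤-trans (≤-trans (m≤m+n m _) (≤-reflexive (sym (lemma m)))) 2m+4≤l
  m+e≡l : m + e ≡ l
  m+e≡l = m+[n∸m]≡n m≤l
  m+4≤e : m + 4 ≤ e
  m+4≤e = +-cancelˡ-≤ m _ _ (begin
    m + (m + 4)  ≡⟨ lemma m ⟨
    2 * m + 4    ≤⟨ 2m+4≤l ⟩
    l            ≡⟨ m+e≡l ⟨
    m + e        ∎)
  4+l≤ : 4 + l ≤ 2 ^ e
  4+l≤ = begin
    4 + l        ≡⟨ cong (λ x → 4 + x) m+e≡l ⟨
    4 + (m + e)  ≡⟨ lemma′ m e ⟩
    m + 4 + e    ≤⟨ +-monoˡ-≤ e m+4≤e ⟩
    e + e        ≡⟨ cong (λ x → e + x) (+-identityʳ e) ⟨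
    2 * e        ≤⟨ 2*n≤2^n e ⟩
    2 ^ e        ∎

-- Below N, where the asymptotic hypothesis gives nothing, c brings the exponent
-- above 5.45.
piecewise : ℕ → ℚ → (ℕ → ℚ) → ℕ → ℚ
piecewise N c f n = if n <ᵇ N then c else f n

piecewise-< : ∀ {N c f n} → n < N → piecewise N c f n ≡ c
piecewise-< {N} {n = n} n<N with n <ᵇ N | <⇒<ᵇ n<N
... | true | _ = refl

piecewise-≥ : ∀ {N c f n} → N ≤ n → piecewise N c f n ≡ f n
piecewise-≥ {N} {n = n} N≤n with n <ᵇ N in eq
... | true  = contradiction N≤n (<⇒≱ (<ᵇ⇒< n N (subst Bool.T (sym eq) tt)))
... | false = refl

piecewise-o[1] : ∀ {N c f} → IsLittleO[1] f → IsLittleO[1] (piecewise N c f)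
piecewise-o[1] {N} {c} {f} f-o ε 0<ε with M , f≤ε ← f-o ε 0<ε =
  N + M , λ n N+M≤n →
    subst (λ x → ℚ.∣ x ∣ ℚ.≤ ε) (sym (piecewise-≥ {N} {c} {f} (≤-trans (m≤m+n N M) N+M≤n)))
      (f≤ε n (≤-trans (m≤n+m M N) N+M≤n))

-- With t = ⌊lg n⌋ ≥ 1, the numerator is an upper bound of 2 lg((8(t + 1))^K), and
-- t + 1 ≤ 2 lg n.
loglog/log : ℕ → ℕ → ℚ
loglog/log K n = + (2 * ((4 + ⌊log₂ suc ⌊log₂ n ⌋ ⌋) * K)) / suc ⌊log₂ n ⌋

loglog/log-o[1] : ∀ K → IsLittleO[1] (loglog/log K)
-- As ε = p/d ≥ 1/d, it is enough that m(4 + l) ≤ t + 1 for m = 2Kd. The double exponential undoes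
-- two logarithms: t ≥ 2^(2m+4), hence l ≥ 2m + 4, as `linear≤2^` requires.
loglog/log-o[1] K ε 0<ε = 2 ^ (2 ^ (2 * m + 4)) , λ n N≤n → bound n (e≤⌊log₂n⌋ N≤n)
  where
  d = ↧ₙ ε
  p = numerator⁺ ε
  m = 2 * K * d
  ε≡ : IsFraction ε p d
  ε≡ = isFraction-nonNeg (ℚ.<⇒≤ 0<ε)
  bound : ∀ n → 2 ^ (2 * m + 4) ≤ ⌊log₂ n ⌋ → ℚ.∣ loglog/log K n ∣ ℚ.≤ ε
  bound n t≥ = subst (ℚ._≤ ε) (sym (ℚ.0≤p⇒∣p∣≡p 0≤f))
    (from (isFraction-≤ {{m*n≢0 (suc t) d}}
      (isFraction-scaleʳ (fraction {loglog/log K n} {s} {suc t} (/-*-cancel (+ s) (suc t))) d) (isFraction-scaleˡ (suc t) ε≡)) (begin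
      2 * ((4 + l) * K) * d   ≡⟨ lemma (4 + l) K d ⟩
      m * (4 + l)             ≤⟨ linear≤2^ m l (e≤⌊log₂n⌋ (≤-trans t≥ (n≤1+n t))) ⟩
      2 ^ l                   ≤⟨ 2^⌊log₂n⌋≤n (s≤s z≤n) ⟩
      suc t                   ≤⟨ m≤m*n (suc t) p {{>-nonZero (isFraction-pos 0<ε)}} ⟩
      suc t * p               ∎))
    where
    open ≤-Reasoning
    t = ⌊log₂ n ⌋
    l = ⌊log₂ suc t ⌋
    s = 2 * ((4 + l) * K)
    lemma : ∀ l K d → 2 * (l * K) * d ≡ 2 * K * d * l
    lemma = solve-∀
    0≤f : 0ℚ ℚ.≤ loglog/log K n
    0≤f = ℚ.nonNegative⁻¹ _ {{ℚ.normalize-nonNeg s (suc t)}}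

-- The leaf bounds with rational exponents

module _ (n h k : ℕ) .{{_ : NonZero k}} (2≤n : 2 ≤ n) (k≤h : k ≤ h) (k≤t : k ≤ ⌊log₂ n ⌋) where

  open Exponents n h k 2≤n k≤h

  private
    t = ⌊log₂ n ⌋
    u = leaves (U k t h)
    0<n : 0 < n
    0<n = ≤-trans (s≤s z≤n) 2≤n

  5·45≤ : ∀ {s} → + 545 / 100 ℚ.≤ s → fromℕ u ≤[ n ^ s ]* (+ h / k) ^ℚ k
  5·45≤ 5·45≤s = leaves≤-intro u {a = 109} {20} (quotient {+ 545 / 100} refl) 5·45≤s (leaves≤n^5·45 n h k 0<n k≤h k≤t)

  u≤n^[6+C] : ∀ C → k ·lg (+ h / k) ≤ C ·lg n → u ≤ n ^ (6 + numerator⁺ C)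
  u≤n^[6+C] C = polynomial u {C} {6} {109} {20} (≤ᵇ⇒≤ 109 120 _) (leaves≤n^5·45 n h k 0<n k≤h k≤t)

  -- The hypothesis 2^k ≤ n^(1/4) is k = o(log n) at ε = 1/4; its fourth power is 16^k ≤ n.
  3≤ : ∀ {s} → fromℕ 3 ℚ.≤ s → fromℕ 2 ^ℚ k ≤[ n ^ + 1 / 4 ]* 1ℚ → fromℕ u ≤[ n ^ s ]* (+ h / k) ^ℚ k
  3≤ 3≤s k=o = leaves≤-intro u {a = 3} {1} (quotient {fromℕ 3} refl) 3≤s (begin
    (u * k ^ k) ^ 1      ≡⟨ ^-identityʳ _ ⟩
    u * k ^ k            ≤⟨ leaves≤n³ n h k 0<n k≤h (≤ᵇ⇒≤ 273 400 _) 16^k≤n ⟩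
    n ^ 3 * h ^ k        ≡⟨ cong (n ^ 3 *_) (^-identityʳ (h ^ k)) ⟨
    n ^ 3 * (h ^ k) ^ 1  ∎)
    where
    open ≤-Reasoning
    instance _ = >-nonZero 0<n
    2^k≡ : IsFraction (fromℕ 2 ^ℚ k) (2 ^ k) 1
    2^k≡ = subst (IsFraction _ _) (^-zeroˡ k) (isFraction-^ (isFraction-fromℕ/1 2) k)
    16^k≤n : 16 ^ k ≤ n
    16^k≤n = begin
      16 ^ k             ≡⟨ ^-comm 2 4 k ⟩
      (2 ^ k) ^ 4        ≡⟨ *-identityʳ _ ⟨
      (2 ^ k) ^ 4 * 1    ≤⟨ _≤[_^⟨_-_⟩/_]*_.inequality (to (≤[^]*⇔ 2^k≡ (isFraction-1 1) {+ 1 / 4} {n} {1} {0} {4} (quotient refl)) k=o) ⟩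
      n ^ 1 * 1          ≡⟨ trans (*-identityʳ (n ^ 1)) (^-identityʳ n) ⟩
      n                  ∎

  -- From t + 1 < 2^(l+1) follows (8(t+1))^k ≤ 2^e with e = (4+l)K. As t ≥ 1, also (2^e)^(t+1) ≤
  -- 2^(2te) ≤ n^(2e), so 2^e ≤ n^(2e/(t+1)).
  1+loglog/log≤ : ∀ {K s} → k ≤ K → 1ℚ ℚ.+ loglog/log K n ℚ.≤ s → fromℕ u ≤[ n ^ s ]* (+ h / k) ^ℚ k
  1+loglog/log≤ {K} k≤K c≤s = leaves≤-intro u {a = suc t + 2 * e} {q = suc t} c≡ c≤s (begin
    (u * k ^ k) ^ suc t
      ≤⟨ ^-monoˡ-≤ (suc t) (leaves≤n*polylog n h k 0<n k≤h (≤ᵇ⇒≤ 273 400 _)) ⟩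
    (n * (8 * suc t) ^ k * h ^ k) ^ suc t
      ≤⟨ ^-monoˡ-≤ (suc t) (*-monoˡ-≤ (h ^ k) (*-monoʳ-≤ n polylog≤2^e)) ⟩
    (n * 2 ^ e * h ^ k) ^ suc t
      ≡⟨ trans (^-distribʳ-* (n * 2 ^ e) (h ^ k) (suc t)) (cong (_* (h ^ k) ^ suc t) (^-distribʳ-* n (2 ^ e) (suc t))) ⟩
    n ^ suc t * (2 ^ e) ^ suc t * (h ^ k) ^ suc t
      ≤⟨ *-monoˡ-≤ ((h ^ k) ^ suc t) (*-monoʳ-≤ (n ^ suc t) 2^e≤) ⟩
    n ^ suc t * n ^ (2 * e) * (h ^ k) ^ suc t
      ≡⟨ cong (_* (h ^ k) ^ suc t) (^-distribˡ-+-* n (suc t) (2 * e)) ⟨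
    n ^ (suc t + 2 * e) * (h ^ k) ^ suc t ∎)
    where
    open ≤-Reasoning
    l = ⌊log₂ suc t ⌋
    e = (4 + l) * K
    c≡ : IsQuotient (1ℚ ℚ.+ loglog/log K n) (suc t + 2 * e) 0 (suc t)
    c≡ = subst₂ (λ a q → IsQuotient (1ℚ ℚ.+ loglog/log K n) a 0 q)
      (cong₂ _+_ (*-identityˡ (suc t)) (*-identityʳ (2 * e))) (*-identityˡ (suc t))
      (isQuotient-+ {1ℚ} {a = 1} {0} {1} (quotient refl) (isQuotient-/ (2 * e) (suc t)))
    polylog≤2^e : (8 * suc t) ^ k ≤ 2 ^ e
    polylog≤2^e = begin
      (8 * suc t) ^ k      ≤⟨ ^-monoˡ-≤ k (*-monoʳ-≤ 8 (<⇒≤ (n<2^[1+⌊log₂n⌋] (suc t)))) ⟩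
      (8 * 2 ^ suc l) ^ k  ≡⟨ cong (_^ k) (^-distribˡ-+-* 2 3 (suc l)) ⟨
      (2 ^ (4 + l)) ^ k    ≤⟨ ^-monoʳ-≤ (2 ^ (4 + l)) {{m^n≢0 2 (4 + l)}} k≤K ⟩
      (2 ^ (4 + l)) ^ K    ≡⟨ ^-*-assoc 2 (4 + l) K ⟩
      2 ^ e                ∎
    2^e≤ : (2 ^ e) ^ suc t ≤ n ^ (2 * e)
    2^e≤ = begin
      (2 ^ e) ^ suc t      ≡⟨ ^-*-assoc 2 e (suc t) ⟩
      2 ^ (e * suc t)      ≤⟨ ^-monoʳ-≤ 2 (*-monoʳ-≤ e (+-monoˡ-≤ t (≤-trans (>-nonZero⁻¹ k) k≤t))) ⟩
      2 ^ (e * (t + t))    ≡⟨ cong (2 ^_) (lemma e t) ⟩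
      2 ^ (t * (2 * e))    ≡⟨ ^-*-assoc 2 t (2 * e) ⟨
      (2 ^ t) ^ (2 * e)    ≤⟨ ^-monoˡ-≤ (2 * e) (2^⌊log₂n⌋≤n 0<n) ⟩
      n ^ (2 * e)          ∎
      where
      lemma : ∀ e t → e * (t + t) ≡ t * (2 * e)
      lemma = solve-∀

-- For integral `k`, the condition k ≤ lg n is k ≤ ⌊lg n⌋. The equality of the two expressions is
-- the third component: for every constant `C`, both bound the same rationals x ≥ 0.
theorem18 : (∀ n h k .{{_ : NonZero k}} → 2 ≤ n → k ≤ h → k ≤ ⌊log₂ n ⌋ →
    StrahlerUniversal k n h (U k ⌊log₂ n ⌋ h))
    × (∃[ C ] ∀ n h k .{{_ : NonZero k}} → 2 ≤ n → k ≤ h → k ≤ ⌊log₂ n ⌋ →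
    fromℕ (leaves (U k ⌊log₂ n ⌋ h)) ≤[ n ^ C ]* (+ h / k) ^ℚ k)
    × (∀ n h k .{{_ : NonZero k}} → 2 ≤ n → k ≤ h → k ≤ ⌊log₂ n ⌋ →
    ∀ C x → 0ℚ ℚ.≤ x →
    x ≤[ n ^ C ]* (+ h / k) ^ℚ k ⇔ x ≤[ n ^ᴿ k ·lg (+ h / k) /lg n ⊕ C ])
    × (∀ C → ∃[ D ] ∀ n h k .{{_ : NonZero k}} → 2 ≤ n → k ≤ h → k ≤ ⌊log₂ n ⌋ →
    k ·lg (+ h / k) ≤ C ·lg n →
    leaves (U k ⌊log₂ n ⌋ h) ≤ n ^ D)
    × (∀ n h k .{{_ : NonZero k}} → 2 ≤ n → k ≤ h → k ≤ ⌊log₂ n ⌋ →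
    fromℕ (leaves (U k ⌊log₂ n ⌋ h)) ≤[ n ^ + 545 / 100 ]* (+ h / k) ^ℚ k)
    × (∀ (k : ℕ → ℕ) → IsLittleO[log] k →
    ∃[ o ] IsLittleO[1] o ×
    (∀ n h .{{_ : NonZero (k n)}} → 2 ≤ n → k n ≤ h → k n ≤ ⌊log₂ n ⌋ →
    fromℕ (leaves (U (k n) ⌊log₂ n ⌋ h))
    ≤[ n ^ fromℕ 3 ℚ.+ o n ]* (+ h / k n) ^ℚ k n))
    × (∀ (k : ℕ → ℕ) → IsBigO[1] k →
    ∃[ o ] IsLittleO[1] o ×
    (∀ n h .{{_ : NonZero (k n)}} → 2 ≤ n → k n ≤ h → k n ≤ ⌊log₂ n ⌋ →
    fromℕ (leaves (U (k n) ⌊log₂ n ⌋ h))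
    ≤[ n ^ 1ℚ ℚ.+ o n ]* (+ h / k n) ^ℚ k n))
theorem18 =
    (λ n h k _ k≤h _ → U-StrahlerUniversal n h k k≤h)
  , (+ 545 / 100 , λ n h k 2≤n k≤h k≤t → 5·45≤ n h k 2≤n k≤h k≤t ℚ.≤-refl)
  , (λ n h k 2≤n k≤h _ → Exponents.n^[C+lg]⇔ n h k 2≤n k≤h)
  , (λ C → 6 + numerator⁺ C , λ n h k 2≤n k≤h k≤t → u≤n^[6+C] n h k 2≤n k≤h k≤t C)
  , (λ n h k 2≤n k≤h k≤t → 5·45≤ n h k 2≤n k≤h k≤t ℚ.≤-refl)
  , little-o
  , big-O
  where
  little-o : ∀ (k : ℕ → ℕ) → IsLittleO[log] k →
    ∃[ o ] IsLittleO[1] o ×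
    (∀ n h .{{_ : NonZero (k n)}} → 2 ≤ n → k n ≤ h → k n ≤ ⌊log₂ n ⌋ →
    fromℕ (leaves (U (k n) ⌊log₂ n ⌋ h))
    ≤[ n ^ fromℕ 3 ℚ.+ o n ]* (+ h / k n) ^ℚ k n)
  little-o k k=o with N , k≤ ← k=o (+ 1 / 4) (from-yes (0ℚ ℚ.<? + 1 / 4)) = o , o-o , bound
    where
    -- From `N` on, 16^k ≤ n and the bound with n^3 holds outright, so the o(1) term is 0 there.
    o = piecewise N (fromℕ 3) (λ _ → 0ℚ)
    o-o : IsLittleO[1] o
    o-o = piecewise-o[1] {N} {fromℕ 3} (λ ε 0<ε → 0 , λ _ _ → ℚ.<⇒≤ 0<ε)
    bound : ∀ n h .{{_ : NonZero (k n)}} → 2 ≤ n → k n ≤ h → k n ≤ ⌊log₂ n ⌋ →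
      fromℕ (leaves (U (k n) ⌊log₂ n ⌋ h)) ≤[ n ^ fromℕ 3 ℚ.+ o n ]* (+ h / k n) ^ℚ k n
    bound n h 2≤n k≤h k≤t with <-≤-connex n N
    ... | inj₁ n<N = 5·45≤ n h (k n) 2≤n k≤h k≤t
      (subst (λ x → + 545 / 100 ℚ.≤ fromℕ 3 ℚ.+ x) (sym (piecewise-< {N} {fromℕ 3} {λ _ → 0ℚ} n<N))
        (from-yes (+ 545 / 100 ℚ.≤? fromℕ 3 ℚ.+ fromℕ 3)))
    ... | inj₂ N≤n = 3≤ n h (k n) 2≤n k≤h k≤t
      (subst (λ x → fromℕ 3 ℚ.≤ fromℕ 3 ℚ.+ x) (sym (piecewise-≥ {N} {fromℕ 3} {λ _ → 0ℚ} N≤n)) 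
        (from-yes (fromℕ 3 ℚ.≤? fromℕ 3 ℚ.+ 0ℚ)))
      (k≤ n (≤-trans (s≤s z≤n) 2≤n) N≤n)

  big-O : ∀ (k : ℕ → ℕ) → IsBigO[1] k →
    ∃[ o ] IsLittleO[1] o ×
    (∀ n h .{{_ : NonZero (k n)}} → 2 ≤ n → k n ≤ h → k n ≤ ⌊log₂ n ⌋ →
    fromℕ (leaves (U (k n) ⌊log₂ n ⌋ h))
    ≤[ n ^ 1ℚ ℚ.+ o n ]* (+ h / k n) ^ℚ k n)
  big-O k (K , N , k≤K) = o , piecewise-o[1] {N} {fromℕ 5} (loglog/log-o[1] K) , bound
    where
    o = piecewise N (fromℕ 5) (loglog/log K)
    bound : ∀ n h .{{_ : NonZero (k n)}} → 2 ≤ n → k n ≤ h → k n ≤ ⌊log₂ n ⌋ →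
      fromℕ (leaves (U (k n) ⌊log₂ n ⌋ h)) ≤[ n ^ 1ℚ ℚ.+ o n ]* (+ h / k n) ^ℚ k n
    bound n h 2≤n k≤h k≤t with <-≤-connex n N
    ... | inj₁ n<N = 5·45≤ n h (k n) 2≤n k≤h k≤t
      (subst (λ x → + 545 / 100 ℚ.≤ 1ℚ ℚ.+ x) (sym (piecewise-< {N} {fromℕ 5} {loglog/log K} n<N))
        (from-yes (+ 545 / 100 ℚ.≤? 1ℚ ℚ.+ fromℕ 5)))
    ... | inj₂ N≤n = 1+loglog/log≤ n h (k n) 2≤n k≤h k≤t (k≤K n N≤n)
      (ℚ.≤-reflexive (cong (1ℚ ℚ.+_) (sym (piecewise-≥ {N} {fromℕ 5} {loglog/log K} N≤n))))
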